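{- For $m\ge1$, let $J(m)$ be the number of overpartitions of $m$ in which no part is divisible by $3$. Let $L(m)$ be the number of overpartitions of $m$ with $n$ copies of $n$ such that (i) with parts in ascending lexicographic order, the weighted difference between each part and the preceding one is $\ge0$, and (ii) whenever a maximal block of two or more consecutive parts has all successive weighted differences equal to $0$, only the smallest part of that block (in lexicographic order) may be overlined. Then $J(m)=L(m)$.
   Context: An overpartition of $m$ is a partition of $m$ in which, for each part size, the first occurrence of that part may (or may not) be overlined. $M=\{n_j: 1\le j\le n\}$; a partition with $n$ copies of $n$ is a finite multiset of elements of $M$ whose values (first entries) sum to $m$; an overpartition with $n$ copies of $n$ is such a multiset in which, for each element $n_j$, at most one occurrence may be overlined. Lexicographic order: $m_i>n_j$ iff $m>n$, or $m=n$ and $i>j$. Weighted difference $((m_i-n_j))=m-n-i-j$. -}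

module Defs where

open import Data.Bool using (Bool; true; false)
import Data.Bool.Properties as Bool
open import Data.Integer as ℤ using (ℤ; +_; 0ℤ)
import Data.Integer.Properties as ℤ
open import Data.List using (List; []; _∷_; length; map; filter; upTo; cartesianProduct; cartesianProductWith)
open import Data.List.Membership.Propositional using (_∈_)
open import Data.List.Membership.Propositional.Properties
  using (∈-filter⁺; ∈-filter⁻; ∈-upTo⁺; ∈-cartesianProduct⁺; ∈-cartesianProductWith⁺; ∈-cartesianProductWith⁻)
open import Data.List.NonEmpty as List⁺ using (List⁺; _∷_; _∷⁺_; [_])
open import Data.List.Properties using (∷-injective)
open import Data.List.Relation.Unary.All as All using (All; []; _∷_; all?)
open import Data.List.Relation.Unary.AllPairs using ([]; _∷_)
open import Data.List.Relation.Unary.Any using (here; there)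
open import Data.List.Relation.Unary.Linked using (Linked; linked?)
open import Data.List.Relation.Unary.Unique.Propositional using (Unique)
import Data.List.Relation.Unary.Unique.Propositional.Properties as Unique
open import Data.Nat using (ℕ; zero; suc; _≤_; s≤s)
import Data.Nat as ℕ
open import Data.Nat.ListAction using (sum)
open import Data.Nat.Divisibility using (_∣_; _∣?_)
import Data.Nat.Properties as ℕ
open import Data.Product using (_×_; _,_; proj₁; proj₂)
open import Data.Product.Properties using (≡-dec)
open import Data.Product.Relation.Binary.Lex.Strict using (×-Lex; ×-decidable)
open import Data.Sum using (_⊎_)
open import Function using (_∘_; id; _⇔_; mk⇔)
open import Relation.Binary using (Rel; Decidable; DecidableEquality)
open import Relation.Binary.PropositionalEquality using (_≡_; refl)
open import Relation.Nullary using (¬_; yes; no; ¬?; _×-dec_; _⊎-dec_)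
import Relation.Unary as U

record Finite {A : Set} (P : A → Set) : Set where
  field
    elements : List A
    unique   : Unique elements
    complete : ∀ x → x ∈ elements ⇔ P x

-- By `unique` and `complete` this number depends only on P.
card : {A : Set} {P : A → Set} → Finite P → ℕ
card F = length (Finite.elements F)

-- The fields after `value` serve only to show that counts are finite.
record PartSystem : Set₁ where
  field
    Part   : Set
    IsPart : Part → Set
    _≺_    : Rel Part _
    value  : Part → ℕ

    _≟_     : DecidableEquality Part
    _≺?_    : Decidable _≺_
    isPart? : U.Decidable IsPart
    positive        : ∀ {a} → IsPart a → 1 ≤ value a
    partsUpTo       : ℕ → List Part
    partsUpTo-unique : ∀ m → Unique (partsUpTo m)
    ∈-partsUpTo     : ∀ {a m} → IsPart a → value a ≤ m → a ∈ partsUpTo m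

-- An occurrence of a part; `true` means overlined.
Occurrence : Set → Set
Occurrence A = A × Bool

part : {A : Set} → Occurrence A → A
part = proj₁

Overlined : {A : Set} → Occurrence A → Set
Overlined (_ , o) = o ≡ true

overlined? : {A : Set} → U.Decidable (Overlined {A})
overlined? (_ , o) = o Bool.≟ true

module Overpartitions (S : PartSystem) where
  open PartSystem S

  -- In a list sorted by ⊴ equal parts are adjacent and only the first of them
  -- may be overlined, so a multiset with at most one overlined occurrence of
  -- each part corresponds to exactly one such list.
  _⊴_ : Rel (Occurrence Part) _
  x ⊴ y = part x ≺ part y ⊎ (part x ≡ part y × ¬ Overlined y)

  IsOverpartition : ℕ → List (Occurrence Part) → Set
  IsOverpartition m xs =
    All (IsPart ∘ part) xs × Linked _⊴_ xs × sum (map (value ∘ part) xs) ≡ m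

  _⊴?_ : Decidable _⊴_
  x ⊴? y = (part x ≺? part y) ⊎-dec ((part x ≟ part y) ×-dec ¬? (overlined? y))

  isOverpartition? : ∀ m → U.Decidable (IsOverpartition m)
  isOverpartition? m xs =
    all? (isPart? ∘ part) xs ×-dec linked? _⊴?_ xs ×-dec (sum (map (value ∘ part) xs) ℕ.≟ m)

  private
    occurrences : ℕ → List (Occurrence Part)
    occurrences m = cartesianProduct (partsUpTo m) (false ∷ true ∷ [])

    occurrences-unique : ∀ m → Unique (occurrences m)
    occurrences-unique m =
      Unique.cartesianProduct⁺ (partsUpTo-unique m) (((λ ()) ∷ []) ∷ [] ∷ [])

    ∈-occurrences : ∀ {m} x → IsPart (part x) → value (part x) ≤ m → x ∈ occurrences m
    ∈-occurrences (a , o) p v = ∈-cartesianProduct⁺ (∈-partsUpTo p v) (∈-bools o)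
      where
      ∈-bools : ∀ o → o ∈ (false ∷ true ∷ [])
      ∈-bools false = here refl
      ∈-bools true  = there (here refl)

    words : {A : Set} → List A → ℕ → List (List A)
    words as zero    = [] ∷ []
    words as (suc k) = [] ∷ cartesianProductWith _∷_ as (words as k)

    words-unique : {A : Set} {as : List A} → Unique as → ∀ k → Unique (words as k)
    words-unique u zero    = [] ∷ []
    words-unique {as = as} u (suc k) =
      All.tabulate []≢ ∷ Unique.cartesianProductWith⁺ _∷_ ∷-injective u (words-unique u k)
      where
      []≢ : ∀ {w} → w ∈ cartesianProductWith _∷_ as (words as k) → ¬ [] ≡ w
      []≢ w∈ refl with ∈-cartesianProductWith⁻ _∷_ as (words as k) w∈
      ... | _ , _ , _ , _ , ()

    ∈-words : ∀ m k {xs} → All (IsPart ∘ part) xs →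
              sum (map (value ∘ part) xs) ≤ m → sum (map (value ∘ part) xs) ≤ k →
              xs ∈ words (occurrences m) k
    ∈-words m zero    []       _  _  = here refl
    ∈-words m (suc k) []       _  _  = here refl
    ∈-words m zero    (p ∷ _)  _  ≤k
      with () ← ℕ.≤-trans (positive p) (ℕ.≤-trans (ℕ.m≤m+n _ _) ≤k)
    ∈-words m (suc k) {x ∷ _} (p ∷ ps) ≤m ≤k =
      there (∈-cartesianProductWith⁺ _∷_
        (∈-occurrences x p (ℕ.≤-trans (ℕ.m≤m+n _ _) ≤m))
        (∈-words m k ps (ℕ.≤-trans (ℕ.m≤n+m _ _) ≤m)
          (ℕ.≤-pred (ℕ.≤-trans (ℕ.+-monoˡ-≤ _ (positive p)) ≤k))))

  finite : {Q : List (Occurrence Part) → Set} → U.Decidable Q →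
           ∀ m → Finite (λ xs → IsOverpartition m xs × Q xs)
  finite {Q} Q? m = record
    { elements = filter P? ws
    ; unique   = Unique.filter⁺ P? (words-unique (occurrences-unique m) m)
    ; complete = λ xs → mk⇔ (proj₂ ∘ ∈-filter⁻ P? {xs = ws}) (λ p → ∈-filter⁺ P? (∈ws p) p)
    }
    where
    ws = words (occurrences m) m

    P? : U.Decidable (λ xs → IsOverpartition m xs × Q xs)
    P? xs = isOverpartition? m xs ×-dec Q? xs

    ∈ws : ∀ {xs} → IsOverpartition m xs × Q xs → xs ∈ ws
    ∈ws ((parts , _ , Σ≡m) , _) = ∈-words m m parts (ℕ.≤-reflexive Σ≡m) (ℕ.≤-reflexive Σ≡m)

ordinary : PartSystem
ordinary = record
  { Part    = ℕ
  ; IsPart  = λ k → 1 ≤ k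
  ; _≺_     = ℕ._<_
  ; value   = id
  ; _≟_     = ℕ._≟_
  ; _≺?_    = ℕ._<?_
  ; isPart? = 1 ℕ.≤?_
  ; positive         = id
  ; partsUpTo        = λ m → upTo (suc m)
  ; partsUpTo-unique = λ m → Unique.upTo⁺ (suc m)
  ; ∈-partsUpTo      = λ _ k≤m → ∈-upTo⁺ (s≤s k≤m)
  }

-- The pair (n , j) stands for nⱼ.
nCopiesOfN : PartSystem
nCopiesOfN = record
  { Part    = ℕ × ℕ
  ; IsPart  = λ (n , j) → 1 ≤ j × j ≤ n
  ; _≺_     = ×-Lex _≡_ ℕ._<_ ℕ._<_
  ; value   = proj₁
  ; _≟_     = ≡-dec ℕ._≟_ ℕ._≟_
  ; _≺?_    = ×-decidable ℕ._≟_ ℕ._<?_ ℕ._<?_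
  ; isPart? = λ (n , j) → (1 ℕ.≤? j) ×-dec (j ℕ.≤? n)
  ; positive         = λ (1≤j , j≤n) → ℕ.≤-trans 1≤j j≤n
  ; partsUpTo        = λ m → cartesianProduct (upTo (suc m)) (upTo (suc m))
  ; partsUpTo-unique = λ m → Unique.cartesianProduct⁺ (Unique.upTo⁺ (suc m)) (Unique.upTo⁺ (suc m))
  ; ∈-partsUpTo      = λ (_ , j≤n) n≤m →
      ∈-cartesianProduct⁺ (∈-upTo⁺ (s≤s n≤m)) (∈-upTo⁺ (s≤s (ℕ.≤-trans j≤n n≤m)))
  }

NoPartDivisibleBy3 : List (Occurrence ℕ) → Set
NoPartDivisibleBy3 = All (λ x → ¬ 3 ∣ part x)

J : ℕ → ℕ
J m = card (Overpartitions.finite ordinary {NoPartDivisibleBy3} (all? (λ x → ¬? (3 ∣? part x))) m)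

-- (( mᵢ - nⱼ )) = m - n - i - j
weightedDifference : ℕ × ℕ → ℕ × ℕ → ℤ
weightedDifference (m , i) (n , j) = + m ℤ.- + n ℤ.- + i ℤ.- + j

-- Lists are ascending, so in both conditions below the later part comes
-- first in the weighted difference.
WeightedDifferences≥0 : List (Occurrence (ℕ × ℕ)) → Set
WeightedDifferences≥0 = Linked (λ x y → 0ℤ ℤ.≤ weightedDifference (part y) (part x))

-- Decomposition into maximal runs of consecutive parts all of whose successive
-- weighted differences are 0.
blocks : List (Occurrence (ℕ × ℕ)) → List (List⁺ (Occurrence (ℕ × ℕ)))
blocks [] = []
blocks (x ∷ xs) with blocks xs
... | []     = [ x ] ∷ []
... | b ∷ bs with weightedDifference (part (List⁺.head b)) (part x) ℤ.≟ 0ℤ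
...   | yes _ = (x ∷⁺ b) ∷ bs
...   | no  _ = [ x ] ∷ b ∷ bs

-- No restriction on a block of length one, whose tail is empty.
OnlySmallestOverlined : List⁺ (Occurrence (ℕ × ℕ)) → Set
OnlySmallestOverlined b = All (λ x → ¬ Overlined x) (List⁺.tail b)

LCondition : List (Occurrence (ℕ × ℕ)) → Set
LCondition xs = WeightedDifferences≥0 xs × All OnlySmallestOverlined (blocks xs)

LCondition? : U.Decidable LCondition
LCondition? xs =
  linked? (λ x y → 0ℤ ℤ.≤? weightedDifference (part y) (part x)) xs
  ×-dec all? (λ b → all? (λ x → ¬? (overlined? x)) (List⁺.tail b)) (blocks xs)

L : ℕ → ℕ
L m = card (Overpartitions.finite nCopiesOfN LCondition? m)

{-# OPTIONS --safe #-}
module Submission where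

-- Write A = Σ_{r ∈ ℤ} q^(r (3r + 1) / 2) and (a)ₙ = (1 − a) (1 − aq) ⋯ (1 − aqⁿ⁻¹).
-- Both generating functions equal A / (q)_∞.  For J this is the triple product
-- ∏ (1 + q^(3i + 1)) (1 + q^(3i + 2)) (1 − q^(3i + 3)) = A.  For L, drawing nⱼ as the
-- interval [n − j , n + j] turns the weighted difference into the gap between
-- consecutive intervals, so that the lists with n parts have generating function
-- q^(n²) (−1)ₙ / ((q)ₙ (q ; q²)ₙ); that the sum over n is A / (q)_∞ follows from the
-- q-binomial theorem in the form
--   Σ_r q^(r (r + 1) / 2) / ((q)_{n − r} (q)_{n + r}) = (−q)ₙ (−1)ₙ / (q)_{2n}
-- and Durfee rectangles.  The q-binomial theorem in base q³ also gives the triple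
-- product.  Infinite products are avoided by working with finite identities modulo
-- q^(N + 1), and all series have coefficients in ℕ, where additive cancellation
-- replaces subtraction.

open import Algebra.Bundles using (CommutativeSemiring)
open import Algebra.Structures.Biased using (isCommutativeSemiringˡ)
open import Data.Bool using (Bool; true; false)
import Data.Integer as ℤ
import Data.Integer.Properties as ℤ
open import Data.Integer.Solver using () renaming (module +-*-Solver to ℤSolver)
open import Data.List using (List; []; _∷_; length; map; _++_)
open import Data.List.Membership.Propositional.Properties using (∈-++⁺ˡ; ∈-++⁺ʳ; ∈-++⁻; ∈-map⁺; ∈-map⁻)
open import Data.List.Membership.Propositional.Properties.WithK using (unique∧set⇒bag)
import Data.List.NonEmpty as List⁺
open import Data.List.Properties using (length-++; length-map; ∷-injectiveʳ)
open import Data.List.Relation.Binary.BagAndSetEquality using (∼bag⇒↭)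
open import Data.List.Relation.Binary.Permutation.Propositional.Properties using (↭-length)
open import Data.List.Relation.Unary.All using (All; []; _∷_; all?)
open import Data.List.Relation.Unary.AllPairs using ([]; _∷_)
open import Data.List.Relation.Unary.Any using (here; there)
open import Data.List.Relation.Unary.Linked using (Linked; []; [-]; _∷_)
import Data.List.Relation.Unary.Unique.Propositional.Properties as Unique
open import Data.Nat using (ℕ; zero; suc; NonZero; >-nonZero; _≤_; _<_; _≤?_; z≤n; s≤s)
import Data.Nat as ℕ
open import Data.Nat.Divisibility using (_∣_; _∣?_; >⇒∤; ∣-refl; ∣m∣n⇒∣m+n; ∣m+n∣m⇒∣n; m∣m*n)
open import Data.Nat.Induction using (<-rec)
open import Data.Nat.ListAction using (sum)
import Data.Nat.Properties as ℕ
open import Data.Nat.Solver using (module +-*-Solver)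
open import Data.Product using (∃; ∃₂; _×_; _,_; proj₁; proj₂)
open import Data.Sum as Sum using (_⊎_; inj₁; inj₂)
open import Data.Unit using (⊤; tt)
open import Function using (_∘_; const; _⇔_; mk⇔; Equivalence)
open import Level using (0ℓ)
open import Relation.Binary.Bundles using (Setoid)
open import Relation.Binary.PropositionalEquality as ≡ using (_≡_)
open import Relation.Nullary using (¬_; ¬?; yes; no; contradiction)
open import Defs

-- Exponents

-- The way from L to A is one step of a Bailey chain. If β_n = Σ_r α_r / ((q)_{n-r} (q)_{n+r}), then
-- Σ_n q^(n²) β_n / (q)_{N-n} = Σ_r q^(r²) α_r / ((q)_{N-r} (q)_{N+r}): split n² = r² + (n-r)(n+r)
-- and sum over n by Durfee rectangles. The q-binomial theorem supplies α_r = q^(r(r+1)/2), and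
-- q^(r²) α_r = q^(r(3r+1)/2) is the summand of A, the same power that the triple product in base q³
-- produces. Without subtraction, dividing by 1 - q^e means proving G = F + q^e G, which determines
-- G. The counts satisfy equations of the same kind, obtained by splitting lists according to their
-- smallest part. For L this works because condition (ii) is local: a part that starts where its
-- predecessor ends must not be overlined.

double : ℕ → ℕ
double zero    = 0
double (suc n) = suc (suc (double n))

double≡n+n : ∀ n → double n ≡ n ℕ.+ n
double≡n+n zero    = ≡.refl
double≡n+n (suc n) = ≡.cong suc (≡.trans (≡.cong suc (double≡n+n n)) (≡.sym (ℕ.+-suc n n)))

triangle : ℕ → ℕ
triangle zero    = 0
triangle (suc n) = triangle n ℕ.+ n

-- ε x y i k is x r + (x + y) r (r − 1) / 2 for the integer r = i − k.
ε : (x y i k : ℕ) → ℕ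
ε x y i       zero    = x ℕ.* i ℕ.+ (x ℕ.+ y) ℕ.* triangle i
ε x y zero    (suc k) = y ℕ.* suc k ℕ.+ (x ℕ.+ y) ℕ.* triangle (suc k)
ε x y (suc i) (suc k) = ε x y i k

-- This is ε(r + 1) - ε(r) = x + (x + y) r. Since r = i - k may be negative, the term with k stands
-- on the left.
ε-sucˡ : ∀ x y i k → ε x y (suc i) k ℕ.+ (x ℕ.+ y) ℕ.* k ≡ ε x y i k ℕ.+ (x ℕ.+ (x ℕ.+ y) ℕ.* i)
ε-sucˡ x y i zero = solve 4 (λ x y i t →
  (x :* (con 1 :+ i) :+ (x :+ y) :* (t :+ i)) :+ (x :+ y) :* con 0
    := (x :* i :+ (x :+ y) :* t) :+ (x :+ (x :+ y) :* i)) ≡.refl x y i (triangle i)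
  where open +-*-Solver
ε-sucˡ x y zero (suc zero) = solve 2 (λ x y →
  (x :* con 0 :+ (x :+ y) :* con 0) :+ (x :+ y) :* con 1
    := (y :* con 1 :+ (x :+ y) :* con 0) :+ (x :+ (x :+ y) :* con 0)) ≡.refl x y
  where open +-*-Solver
ε-sucˡ x y zero (suc (suc k)) = solve 4 (λ x y k t →
  (y :* (con 1 :+ k) :+ (x :+ y) :* (t :+ k)) :+ (x :+ y) :* (con 2 :+ k)
    := (y :* (con 2 :+ k) :+ (x :+ y) :* ((t :+ k) :+ (con 1 :+ k))) :+ (x :+ (x :+ y) :* con 0))
  ≡.refl x y k (triangle k)
  where open +-*-Solver
ε-sucˡ x y (suc i) (suc k) = begin
  ε x y (suc i) k ℕ.+ c ℕ.* suc k
    ≡⟨ solve 3 (λ e c k → e :+ c :* (con 1 :+ k) := (e :+ c :* k) :+ c) ≡.refl (ε x y (suc i) k) c k ⟩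
  ε x y (suc i) k ℕ.+ c ℕ.* k ℕ.+ c
    ≡⟨ ≡.cong (ℕ._+ c) (ε-sucˡ x y i k) ⟩
  ε x y i k ℕ.+ (x ℕ.+ c ℕ.* i) ℕ.+ c
    ≡⟨ solve 4 (λ e x c i → e :+ (x :+ c :* i) :+ c := e :+ (x :+ c :* (con 1 :+ i))) ≡.refl (ε x y i k) x c i ⟩
  ε x y i k ℕ.+ (x ℕ.+ c ℕ.* suc i) ∎
  where
  open +-*-Solver
  open ≡.≡-Reasoning
  c = x ℕ.+ y

-- The hypothesis says r = a - j. The weight (x + y) j from the q-Pascal rule therefore turns the
-- increment x + (x + y) r into a quantity independent of i, which can leave the sum in `∑-step-x`.
-- `ε-step-y` does the same for r lowered by 1.
ε-step-x : ∀ x y i j k a → i ℕ.+ j ≡ a ℕ.+ k →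
  (x ℕ.+ y) ℕ.* j ℕ.+ ε x y (suc i) k ≡ (x ℕ.+ (x ℕ.+ y) ℕ.* a) ℕ.+ ε x y i k
ε-step-x x y i j k a i+j≡a+k = ℕ.+-cancelʳ-≡ (c ℕ.* k) _ _ (begin
  c ℕ.* j ℕ.+ ε x y (suc i) k ℕ.+ c ℕ.* k
    ≡⟨ ℕ.+-assoc (c ℕ.* j) _ _ ⟩
  c ℕ.* j ℕ.+ (ε x y (suc i) k ℕ.+ c ℕ.* k)
    ≡⟨ ≡.cong (c ℕ.* j ℕ.+_) (ε-sucˡ x y i k) ⟩
  c ℕ.* j ℕ.+ (ε x y i k ℕ.+ (x ℕ.+ c ℕ.* i))
    ≡⟨ solve 5 (λ c j e x i → c :* j :+ (e :+ (x :+ c :* i)) := x :+ e :+ c :* (i :+ j)) ≡.refl c j (ε x y i k) x i ⟩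
  x ℕ.+ ε x y i k ℕ.+ c ℕ.* (i ℕ.+ j)
    ≡⟨ ≡.cong (λ s → x ℕ.+ ε x y i k ℕ.+ c ℕ.* s) i+j≡a+k ⟩
  x ℕ.+ ε x y i k ℕ.+ c ℕ.* (a ℕ.+ k)
    ≡⟨ solve 5 (λ c k e x a → x :+ e :+ c :* (a :+ k) := (x :+ c :* a) :+ e :+ c :* k) ≡.refl c k (ε x y i k) x a ⟩
  x ℕ.+ c ℕ.* a ℕ.+ ε x y i k ℕ.+ c ℕ.* k ∎)
  where
  open +-*-Solver
  open ≡.≡-Reasoning
  c = x ℕ.+ y

ε-step-y : ∀ x y i k →
  (x ℕ.+ y) ℕ.* i ℕ.+ ε x y i (suc k) ≡ (y ℕ.+ (x ℕ.+ y) ℕ.* k) ℕ.+ ε x y i k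
ε-step-y x y i k = ℕ.+-cancelʳ-≡ x _ _ (begin
  c ℕ.* i ℕ.+ ε x y i (suc k) ℕ.+ x
    ≡⟨ solve 4 (λ c i e x → c :* i :+ e :+ x := e :+ (x :+ c :* i)) ≡.refl c i (ε x y i (suc k)) x ⟩
  ε x y i (suc k) ℕ.+ (x ℕ.+ c ℕ.* i)
    ≡⟨ ε-sucˡ x y i (suc k) ⟨
  ε x y i k ℕ.+ c ℕ.* suc k
    ≡⟨ solve 4 (λ e x y k → e :+ (x :+ y) :* (con 1 :+ k) := (y :+ (x :+ y) :* k) :+ e :+ x) ≡.refl (ε x y i k) x y k ⟩
  y ℕ.+ c ℕ.* k ℕ.+ ε x y i k ℕ.+ x ∎)
  where
  open +-*-Solver
  open ≡.≡-Reasoning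
  c = x ℕ.+ y

n*n≡n+2triangle : ∀ n → n ℕ.* n ≡ n ℕ.+ 2 ℕ.* triangle n
n*n≡n+2triangle zero = ≡.refl
n*n≡n+2triangle (suc n) = begin
  suc n ℕ.* suc n
    ≡⟨ solve 1 (λ n → (con 1 :+ n) :* (con 1 :+ n) := con 1 :+ con 2 :* n :+ n :* n) ≡.refl n ⟩
  1 ℕ.+ 2 ℕ.* n ℕ.+ n ℕ.* n
    ≡⟨ ≡.cong (1 ℕ.+ 2 ℕ.* n ℕ.+_) (n*n≡n+2triangle n) ⟩
  1 ℕ.+ 2 ℕ.* n ℕ.+ (n ℕ.+ 2 ℕ.* triangle n)
    ≡⟨ solve 2 (λ n t → con 1 :+ con 2 :* n :+ (n :+ con 2 :* t) := con 1 :+ n :+ con 2 :* (t :+ n)) ≡.refl n (triangle n) ⟩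
  suc n ℕ.+ 2 ℕ.* triangle (suc n) ∎
  where
  open +-*-Solver
  open ≡.≡-Reasoning

-- With r = i − n the two sides are n² + r (r + 1) / 2 and r (3r + 1) / 2 + (n + r) (n − r).
ε₁-ε₃ : ∀ i j n → i ℕ.+ j ≡ n ℕ.+ n → n ℕ.* n ℕ.+ ε 1 0 i n ≡ ε 2 1 i n ℕ.+ i ℕ.* j
ε₁-ε₃ zero    zero    zero    eq = ≡.refl
ε₁-ε₃ zero    j       (suc n) eq = begin
  suc n ℕ.* suc n ℕ.+ (0 ℕ.* suc n ℕ.+ 1 ℕ.* t)
    ≡⟨ ≡.cong (ℕ._+ (0 ℕ.* suc n ℕ.+ 1 ℕ.* t)) (n*n≡n+2triangle (suc n)) ⟩
  suc n ℕ.+ 2 ℕ.* t ℕ.+ (0 ℕ.* suc n ℕ.+ 1 ℕ.* t)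
    ≡⟨ solve 2 (λ m t → m :+ con 2 :* t :+ (con 0 :* m :+ con 1 :* t) := (con 1 :* m :+ con 3 :* t) :+ con 0) ≡.refl (suc n) t ⟩
  1 ℕ.* suc n ℕ.+ 3 ℕ.* t ℕ.+ 0 ∎
  where
  open +-*-Solver
  open ≡.≡-Reasoning
  t = triangle (suc n)
ε₁-ε₃ (suc i) zero    (suc n) eq = begin
  suc n ℕ.* suc n ℕ.+ ε 1 0 i n
    ≡⟨ ≡.cong (λ i → suc n ℕ.* suc n ℕ.+ ε 1 0 i n) i≡ ⟩
  suc n ℕ.* suc n ℕ.+ ε 1 0 (suc n ℕ.+ n) n
    ≡⟨ ≡.cong₂ ℕ._+_ (n*n≡n+2triangle (suc n)) (ε-cancel 1 0 (suc n) n) ⟩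
  suc n ℕ.+ 2 ℕ.* t ℕ.+ (1 ℕ.* suc n ℕ.+ 1 ℕ.* t)
    ≡⟨ solve 2 (λ m t → m :+ con 2 :* t :+ (con 1 :* m :+ con 1 :* t) := (con 2 :* m :+ con 3 :* t)) ≡.refl (suc n) t ⟩
  2 ℕ.* suc n ℕ.+ 3 ℕ.* t
    ≡⟨ ≡.sym (ε-cancel 2 1 (suc n) n) ⟩
  ε 2 1 (suc n ℕ.+ n) n
    ≡⟨ ≡.cong (λ i → ε 2 1 i n) (≡.sym i≡) ⟩
  ε 2 1 i n
    ≡⟨ ≡.sym (ℕ.+-identityʳ _) ⟩
  ε 2 1 i n ℕ.+ 0
    ≡⟨ ≡.cong (ε 2 1 i n ℕ.+_) (≡.sym (ℕ.*-zeroʳ (suc i))) ⟩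
  ε 2 1 i n ℕ.+ suc i ℕ.* 0 ∎
  where
  open +-*-Solver
  open ≡.≡-Reasoning
  t = triangle (suc n)
  i≡ : i ≡ suc n ℕ.+ n
  i≡ = ≡.trans (≡.sym (ℕ.+-identityʳ i)) (≡.trans (ℕ.suc-injective eq) (ℕ.+-suc n n))
  ε-cancel : ∀ x y d k → ε x y (d ℕ.+ k) k ≡ ε x y d 0
  ε-cancel x y d zero = ≡.cong (λ i → ε x y i 0) (ℕ.+-identityʳ d)
  ε-cancel x y d (suc k) = ≡.trans (≡.cong (λ i → ε x y i (suc k)) (ℕ.+-suc d k)) (ε-cancel x y d k)
ε₁-ε₃ (suc i) (suc j) (suc n) eq = begin
  suc n ℕ.* suc n ℕ.+ ε 1 0 i n
    ≡⟨ solve 2 (λ n e → (con 1 :+ n) :* (con 1 :+ n) :+ e := con 1 :+ (n :+ n) :+ (n :* n :+ e)) ≡.refl n (ε 1 0 i n) ⟩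
  1 ℕ.+ (n ℕ.+ n) ℕ.+ (n ℕ.* n ℕ.+ ε 1 0 i n)
    ≡⟨ ≡.cong₂ (λ s e → 1 ℕ.+ s ℕ.+ e) (≡.sym eq′) (ε₁-ε₃ i j n eq′) ⟩
  1 ℕ.+ (i ℕ.+ j) ℕ.+ (ε 2 1 i n ℕ.+ i ℕ.* j)
    ≡⟨ solve 3 (λ i j e → con 1 :+ (i :+ j) :+ (e :+ i :* j) := e :+ (con 1 :+ i) :* (con 1 :+ j)) ≡.refl i j (ε 2 1 i n) ⟩
  ε 2 1 i n ℕ.+ suc i ℕ.* suc j ∎
  where
  open +-*-Solver
  open ≡.≡-Reasoning
  eq′ : i ℕ.+ j ≡ n ℕ.+ n
  eq′ = ℕ.suc-injective (≡.trans (≡.sym (ℕ.+-suc i j)) (≡.trans (ℕ.suc-injective eq) (ℕ.+-suc n n)))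

ε-+ : ∀ x y i k l → ε x y (l ℕ.+ i) (l ℕ.+ k) ≡ ε x y i k
ε-+ x y i k zero    = ≡.refl
ε-+ x y i k (suc l) = ε-+ x y i k l

-- Identities between finite products

-- X d and geo d stand for qᵈ and 1 / (1 − qᵈ).
record HasGeometricSeries (R : CommutativeSemiring 0ℓ 0ℓ)
                          (X geo : ℕ → CommutativeSemiring.Carrier R) : Set where
  open CommutativeSemiring R
  field
    +-cancelˡ  : ∀ a {b c} → a + b ≈ a + c → b ≈ c
    X-zero     : X 0 ≈ 1#
    X-+        : ∀ d e → X (d ℕ.+ e) ≈ X d * X e
    geo-unfold : ∀ e .{{_ : NonZero e}} → geo e ≈ 1# + X e * geo e

module QSeries (R : CommutativeSemiring 0ℓ 0ℓ) (X geo : ℕ → CommutativeSemiring.Carrier R)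
               (hasGeometricSeries : HasGeometricSeries R X geo) where

  open CommutativeSemiring R
  open HasGeometricSeries hasGeometricSeries
  open import Relation.Binary.Reasoning.Setoid setoid
  open import Algebra.Solver.Ring.NaturalCoefficients.Default R

  X-cong : ∀ {d e} → d ≡ e → X d ≈ X e
  X-cong ≡.refl = refl

  -- Division by 1 - q^e. Unfolding `geo e` and unfolding G evaluate `geo e * G` in two ways that
  -- share the summand `X e * (geo e * G)`, which cancels.
  geo-unique : ∀ e .{{_ : NonZero e}} {F G} → G ≈ F + X e * G → G ≈ geo e * F
  geo-unique e {F} {G} G≈ = +-cancelˡ (X e * (geo e * G)) (begin
    X e * (geo e * G) + G
      ≈⟨ solve 3 (λ x v g → x :* (v :* g) :+ g := (con 1 :+ x :* v) :* g) refl (X e) (geo e) G ⟩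
    (1# + X e * geo e) * G
      ≈⟨ *-congʳ (geo-unfold e) ⟨
    geo e * G
      ≈⟨ *-congˡ G≈ ⟩
    geo e * (F + X e * G)
      ≈⟨ solve 4 (λ x v g f → v :* (f :+ x :* g) := x :* (v :* g) :+ v :* f) refl (X e) (geo e) G F ⟩
    X e * (geo e * G) + geo e * F ∎)

  -- The summand receives both i and j with i + j = n, which avoids truncated subtraction.
  ∑ : ℕ → (ℕ → ℕ → Carrier) → Carrier
  ∑ zero    f = f 0 0
  ∑ (suc n) f = f 0 (suc n) + ∑ n (λ i j → f (suc i) j)

  ∑-cong : ∀ n {f g} → (∀ i j → i ℕ.+ j ≡ n → f i j ≈ g i j) → ∑ n f ≈ ∑ n g
  ∑-cong zero    f≈g = f≈g 0 0 ≡.refl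
  ∑-cong (suc n) f≈g =
    +-cong (f≈g 0 (suc n) ≡.refl) (∑-cong n (λ i j i+j≡n → f≈g (suc i) j (≡.cong suc i+j≡n)))

  ∑-distrib-+ : ∀ n f g → ∑ n (λ i j → f i j + g i j) ≈ ∑ n f + ∑ n g
  ∑-distrib-+ zero    f g = refl
  ∑-distrib-+ (suc n) f g = begin
    (f 0 (suc n) + g 0 (suc n)) + ∑ n (λ i j → f (suc i) j + g (suc i) j)
      ≈⟨ +-congˡ (∑-distrib-+ n _ _) ⟩
    (f 0 (suc n) + g 0 (suc n)) + (∑ n (λ i j → f (suc i) j) + ∑ n (λ i j → g (suc i) j))
      ≈⟨ solve 4 (λ a b c d → (a :+ b) :+ (c :+ d) := (a :+ c) :+ (b :+ d)) refl _ _ _ _ ⟩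
    ∑ (suc n) f + ∑ (suc n) g ∎

  *-distribˡ-∑ : ∀ n a f → a * ∑ n f ≈ ∑ n (λ i j → a * f i j)
  *-distribˡ-∑ zero    a f = refl
  *-distribˡ-∑ (suc n) a f = trans (distribˡ _ _ _) (+-congˡ (*-distribˡ-∑ n a _))

  ∑-last : ∀ n f → ∑ (suc n) f ≈ ∑ n (λ i j → f i (suc j)) + f (suc n) 0
  ∑-last zero    f = refl
  ∑-last (suc n) f = trans (+-congˡ (∑-last n (λ i j → f (suc i) j))) (sym (+-assoc _ _ _))

  -- The sum of f l i j over the triples with l + i = m and l + j = n.
  ∑³ : ℕ → ℕ → (ℕ → ℕ → ℕ → Carrier) → Carrier
  ∑³ zero    n       f = f 0 0 n
  ∑³ (suc m) zero    f = f 0 (suc m) 0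
  ∑³ (suc m) (suc n) f = f 0 (suc m) (suc n) + ∑³ m n (λ l → f (suc l))

  ∑³-cong : ∀ m n {f g} → (∀ l i j → l ℕ.+ i ≡ m → l ℕ.+ j ≡ n → f l i j ≈ g l i j) →
            ∑³ m n f ≈ ∑³ m n g
  ∑³-cong zero    n       f≈g = f≈g 0 0 n ≡.refl ≡.refl
  ∑³-cong (suc m) zero    f≈g = f≈g 0 (suc m) 0 ≡.refl ≡.refl
  ∑³-cong (suc m) (suc n) f≈g = +-cong (f≈g 0 (suc m) (suc n) ≡.refl ≡.refl)
    (∑³-cong m n (λ l i j p q → f≈g (suc l) i j (≡.cong suc p) (≡.cong suc q)))

  ∑³-distrib-+ : ∀ m n f g → ∑³ m n (λ l i j → f l i j + g l i j) ≈ ∑³ m n f + ∑³ m n g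
  ∑³-distrib-+ zero    n       f g = refl
  ∑³-distrib-+ (suc m) zero    f g = refl
  ∑³-distrib-+ (suc m) (suc n) f g =
    trans (+-congˡ (∑³-distrib-+ m n (λ l → f (suc l)) (λ l → g (suc l))))
          (solve 4 (λ a b c d → (a :+ b) :+ (c :+ d) := (a :+ c) :+ (b :+ d)) refl _ _ _ _)

  *-distribˡ-∑³ : ∀ m n a f → a * ∑³ m n f ≈ ∑³ m n (λ l i j → a * f l i j)
  *-distribˡ-∑³ zero    n       a f = refl
  *-distribˡ-∑³ (suc m) zero    a f = refl
  *-distribˡ-∑³ (suc m) (suc n) a f =
    trans (distribˡ _ _ _) (+-congˡ (*-distribˡ-∑³ m n a (λ l → f (suc l))))

  -- Both sides run over the triples with 2l + i + j = 2n; the right side fixes l on the outside.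
  ∑-∑³ : ∀ n f → ∑ (double n) (λ i j → ∑³ i j f) ≈ ∑ n (λ l m → ∑ (double m) (f l))
  ∑-∑³ zero    f = refl
  ∑-∑³ (suc n) f = begin
    ∑ (suc (suc (double n))) (λ i j → ∑³ i j f)
      ≈⟨ ∑-cong (suc (suc (double n))) (λ i j _ → peel i j) ⟩
    ∑ (suc (suc (double n))) (λ i j → f 0 i j + inner i j)
      ≈⟨ ∑-distrib-+ (suc (suc (double n))) (f 0) inner ⟩
    ∑ (suc (suc (double n))) (f 0) + ∑ (suc (suc (double n))) inner
      -- `inner` vanishes at both ends, so the sum over i + j = 2n + 2 loses two terms and becomes
      -- one over i + j = 2n.
      ≈⟨ +-congˡ (trans (+-identityˡ _) (trans (∑-last (double n) (λ i → inner (suc i))) (+-identityʳ _))) ⟩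
    ∑ (suc (suc (double n))) (f 0) + ∑ (double n) (λ i j → ∑³ i j (λ l → f (suc l)))
      ≈⟨ +-congˡ (∑-∑³ n (λ l → f (suc l))) ⟩
    ∑ (suc n) (λ l m → ∑ (double m) (f l)) ∎
    where
    inner : ℕ → ℕ → Carrier
    inner zero    j       = 0#
    inner (suc i) zero    = 0#
    inner (suc i) (suc j) = ∑³ i j (λ l → f (suc l))
    peel : ∀ i j → ∑³ i j f ≈ f 0 i j + inner i j
    peel zero    j       = sym (+-identityʳ _)
    peel (suc i) zero    = sym (+-identityʳ _)
    peel (suc i) (suc j) = refl

  -- The products 1 / (qᶜ ; qᶜ)ₙ and Durfee rectangles

  module Base (c : ℕ) .{{_ : NonZero c}} where

    Q : ℕ → Carrier
    Q zero    = 1#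
    Q (suc n) = geo (c ℕ.* suc n) * Q n

    -- Q⁻ n is Q (n − 1), with the convention 1 / (qᶜ ; qᶜ)₋₁ = 0.
    Q⁻ : ℕ → Carrier
    Q⁻ zero    = 0#
    Q⁻ (suc n) = Q n

    Q-unfold : ∀ n → Q n ≈ Q⁻ n + X (c ℕ.* n) * Q n
    Q-unfold zero = begin
      1#                             ≈⟨ X-zero ⟨
      X 0                            ≈⟨ X-cong (≡.sym (ℕ.*-zeroʳ c)) ⟩
      X (c ℕ.* 0)                    ≈⟨ solve 1 (λ x → x := con 0 :+ x :* con 1) refl _ ⟩
      0# + X (c ℕ.* 0) * 1#          ∎
    Q-unfold (suc n) = begin
      geo (c ℕ.* suc n) * Q n
        ≈⟨ *-congʳ (geo-unfold (c ℕ.* suc n) {{ℕ.m*n≢0 c (suc n)}}) ⟩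
      (1# + X (c ℕ.* suc n) * geo (c ℕ.* suc n)) * Q n
        ≈⟨ solve 3 (λ x v g → (con 1 :+ x :* v) :* g := g :+ x :* (v :* g)) refl _ _ _ ⟩
      Q n + X (c ℕ.* suc n) * (geo (c ℕ.* suc n) * Q n) ∎

    ∑-Q⁻ˡ : ∀ n (w : ℕ → ℕ → Carrier) →
      ∑ (suc n) (λ i j → w i j * (Q⁻ i * Q j)) ≈ ∑ n (λ i j → w (suc i) j * (Q i * Q j))
    ∑-Q⁻ˡ n w = trans (+-congʳ (trans (*-congˡ (zeroˡ _)) (zeroʳ _))) (+-identityˡ _)

    ∑-Q⁻ʳ : ∀ n (w : ℕ → ℕ → Carrier) →
      ∑ (suc n) (λ i j → w i j * (Q i * Q⁻ j)) ≈ ∑ n (λ i j → w i (suc j) * (Q i * Q j))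
    ∑-Q⁻ʳ n w = trans (∑-last n (λ i j → w i j * (Q i * Q⁻ j)))
      (trans (+-congˡ (trans (*-congˡ (zeroʳ _)) (zeroʳ _))) (+-identityʳ _))

    -- The q-Pascal rule: 1 - q^(c(i+j)) = (1 - q^(cj)) + q^(cj) (1 - q^(ci)), multiplied by
    -- `Q i * Q j`. The convention for `Q⁻` makes it valid when i or j is 0.
    Q*Q-unfold : ∀ i j → Q i * Q j ≈
      (Q i * Q⁻ j + X (c ℕ.* j) * (Q⁻ i * Q j)) + X (c ℕ.* (i ℕ.+ j)) * (Q i * Q j)
    Q*Q-unfold i j = begin
      Q i * Q j
        ≈⟨ *-congˡ (Q-unfold j) ⟩
      Q i * (Q⁻ j + X (c ℕ.* j) * Q j)
        ≈⟨ trans (distribˡ _ _ _) (+-congˡ (*-congʳ (Q-unfold i))) ⟩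
      Q i * Q⁻ j + (Q⁻ i + X (c ℕ.* i) * Q i) * (X (c ℕ.* j) * Q j)
        ≈⟨ solve 6 (λ qi qj mi mj xi xj →
             qi :* mj :+ (mi :+ xi :* qi) :* (xj :* qj)
             := (qi :* mj :+ xj :* (mi :* qj)) :+ (xi :* xj) :* (qi :* qj))
             refl (Q i) (Q j) (Q⁻ i) (Q⁻ j) (X (c ℕ.* i)) (X (c ℕ.* j)) ⟩
      (Q i * Q⁻ j + X (c ℕ.* j) * (Q⁻ i * Q j)) + (X (c ℕ.* i) * X (c ℕ.* j)) * (Q i * Q j)
        ≈⟨ +-congˡ (*-congʳ (trans (sym (X-+ _ _)) (X-cong (≡.sym (ℕ.*-distribˡ-+ c i j))))) ⟩
      (Q i * Q⁻ j + X (c ℕ.* j) * (Q⁻ i * Q j)) + X (c ℕ.* (i ℕ.+ j)) * (Q i * Q j) ∎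

    private
      ∑³-Q⁻₁ : ∀ m n (w : ℕ → ℕ → ℕ → Carrier) →
        ∑³ (suc m) (suc n) (λ l i j → w l i j * (Q⁻ l * (Q i * Q j)))
          ≈ ∑³ m n (λ l i j → w (suc l) i j * (Q l * (Q i * Q j)))
      ∑³-Q⁻₁ m n w = trans (+-congʳ (trans (*-congˡ (zeroˡ _)) (zeroʳ _))) (+-identityˡ _)

      ∑³-0ᵢ : ∀ m n f → (∀ l j → f l 0 j ≈ 0#) →
        ∑³ (suc m) n f ≈ ∑³ m n (λ l i j → f l (suc i) j)
      ∑³-0ᵢ zero    zero    f f≈0 = refl
      ∑³-0ᵢ (suc m) zero    f f≈0 = refl
      ∑³-0ᵢ zero    (suc n) f f≈0 = trans (+-congˡ (f≈0 1 n)) (+-identityʳ _)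
      ∑³-0ᵢ (suc m) (suc n) f f≈0 = +-congˡ (∑³-0ᵢ m n (λ l → f (suc l)) (λ l → f≈0 (suc l)))

      ∑³-0ⱼ : ∀ m n f → (∀ l i → f l i 0 ≈ 0#) →
        ∑³ m (suc n) f ≈ ∑³ m n (λ l i j → f l i (suc j))
      ∑³-0ⱼ zero          n       f f≈0 = refl
      ∑³-0ⱼ (suc zero)    zero    f f≈0 = trans (+-congˡ (f≈0 1 0)) (+-identityʳ _)
      ∑³-0ⱼ (suc (suc m)) zero    f f≈0 = trans (+-congˡ (f≈0 1 (suc m))) (+-identityʳ _)
      ∑³-0ⱼ (suc m)       (suc n) f f≈0 = +-congˡ (∑³-0ⱼ m n (λ l → f (suc l)) (λ l → f≈0 (suc l)))

    durfee : ℕ → ℕ → ℕ → Carrier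
    durfee l i j = X (c ℕ.* (i ℕ.* j)) * (Q l * (Q i * Q j))

    private
      -- The q-Pascal rule is applied to `Q l * Q j`, because l + j = n + 1 is constant and its last
      -- term leaves the sum. In the other two terms j is lowered, or a lowered l is traded for a
      -- lowered i; `Q-unfold i` recombines them into the sum for n.
      ∑³-durfee-suc : ∀ m n → ∑³ m (suc n) durfee ≈
                      ∑³ m n durfee + X (c ℕ.* suc n) * ∑³ m (suc n) durfee
      ∑³-durfee-suc m n = begin
        ∑³ m (suc n) durfee
          ≈⟨ ∑³-cong m (suc n) split ⟩
        ∑³ m (suc n) (λ l i j →
          (X (c ℕ.* (i ℕ.* j)) * (Q l * (Q i * Q⁻ j)) + X (c ℕ.* (suc i ℕ.* j)) * (Q⁻ l * (Q i * Q j)))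
            + X (c ℕ.* suc n) * durfee l i j)
          ≈⟨ ∑³-distrib-+ m (suc n) _ _ ⟩
        ∑³ m (suc n) (λ l i j →
          X (c ℕ.* (i ℕ.* j)) * (Q l * (Q i * Q⁻ j)) + X (c ℕ.* (suc i ℕ.* j)) * (Q⁻ l * (Q i * Q j)))
          + ∑³ m (suc n) (λ l i j → X (c ℕ.* suc n) * durfee l i j)
          ≈⟨ +-cong (∑³-distrib-+ m (suc n) _ _) (sym (*-distribˡ-∑³ m (suc n) _ durfee)) ⟩
        (∑³ m (suc n) (λ l i j → X (c ℕ.* (i ℕ.* j)) * (Q l * (Q i * Q⁻ j)))
          + ∑³ m (suc n) (λ l i j → X (c ℕ.* (suc i ℕ.* j)) * (Q⁻ l * (Q i * Q j))))
          + X (c ℕ.* suc n) * ∑³ m (suc n) durfee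
          ≈⟨ +-congʳ (+-cong
               (∑³-0ⱼ m n (λ l i j → X (c ℕ.* (i ℕ.* j)) * (Q l * (Q i * Q⁻ j)))
                 (λ l i → trans (*-congˡ (trans (*-congˡ (zeroʳ _)) (zeroʳ _))) (zeroʳ _)))
               (reindex m)) ⟩
        (∑³ m n (λ l i j → X (c ℕ.* (i ℕ.* suc j)) * (Q l * (Q i * Q j)))
          + ∑³ m n (λ l i j → X (c ℕ.* (i ℕ.* j)) * (Q l * (Q⁻ i * Q j))))
          + X (c ℕ.* suc n) * ∑³ m (suc n) durfee
          ≈⟨ +-congʳ (trans (sym (∑³-distrib-+ m n _ _)) (∑³-cong m n (λ l i j _ _ → merge l i j))) ⟩
        ∑³ m n durfee + X (c ℕ.* suc n) * ∑³ m (suc n) durfee ∎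
        where
        X-*suc : ∀ i j → X (c ℕ.* (i ℕ.* j)) * X (c ℕ.* i) ≈ X (c ℕ.* (i ℕ.* suc j))
        X-*suc i j = trans (sym (X-+ _ _)) (X-cong
          (≡.trans (≡.sym (ℕ.*-distribˡ-+ c (i ℕ.* j) i))
            (≡.cong (c ℕ.*_) (≡.trans (ℕ.+-comm _ i) (≡.sym (ℕ.*-suc i j))))))
        X-suc* : ∀ i j → X (c ℕ.* (i ℕ.* j)) * X (c ℕ.* j) ≈ X (c ℕ.* (suc i ℕ.* j))
        X-suc* i j = trans (sym (X-+ _ _)) (X-cong
          (≡.trans (≡.sym (ℕ.*-distribˡ-+ c (i ℕ.* j) j)) (≡.cong (c ℕ.*_) (ℕ.+-comm _ j))))
        split : ∀ l i j → l ℕ.+ i ≡ m → l ℕ.+ j ≡ suc n → durfee l i j ≈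
          (X (c ℕ.* (i ℕ.* j)) * (Q l * (Q i * Q⁻ j)) + X (c ℕ.* (suc i ℕ.* j)) * (Q⁻ l * (Q i * Q j)))
            + X (c ℕ.* suc n) * durfee l i j
        split l i j _ l+j≡1+n = begin
          e * (Q l * (Q i * Q j))
            ≈⟨ solve 4 (λ e a b d → e :* (a :* (b :* d)) := e :* (b :* (a :* d))) refl e (Q l) (Q i) (Q j) ⟩
          e * (Q i * (Q l * Q j))
            ≈⟨ *-congˡ (*-congˡ (Q*Q-unfold l j)) ⟩
          e * (Q i * ((Q l * Q⁻ j + X (c ℕ.* j) * (Q⁻ l * Q j)) + X (c ℕ.* (l ℕ.+ j)) * (Q l * Q j)))
            ≈⟨ solve 8 (λ e qi ql qj ml mj xj z →
                 e :* (qi :* ((ql :* mj :+ xj :* (ml :* qj)) :+ z :* (ql :* qj)))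
                 := (e :* (ql :* (qi :* mj)) :+ (e :* xj) :* (ml :* (qi :* qj))) :+ z :* (e :* (ql :* (qi :* qj))))
                 refl e (Q i) (Q l) (Q j) (Q⁻ l) (Q⁻ j) (X (c ℕ.* j)) (X (c ℕ.* (l ℕ.+ j))) ⟩
          (e * (Q l * (Q i * Q⁻ j)) + (e * X (c ℕ.* j)) * (Q⁻ l * (Q i * Q j))) + X (c ℕ.* (l ℕ.+ j)) * durfee l i j
            ≈⟨ +-cong (+-congˡ (*-congʳ (X-suc* i j))) (*-congʳ (X-cong (≡.cong (c ℕ.*_) l+j≡1+n))) ⟩
          (e * (Q l * (Q i * Q⁻ j)) + X (c ℕ.* (suc i ℕ.* j)) * (Q⁻ l * (Q i * Q j))) + X (c ℕ.* suc n) * durfee l i j ∎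
          where e = X (c ℕ.* (i ℕ.* j))
        reindex : ∀ m →
          ∑³ m (suc n) (λ l i j → X (c ℕ.* (suc i ℕ.* j)) * (Q⁻ l * (Q i * Q j)))
            ≈ ∑³ m n (λ l i j → X (c ℕ.* (i ℕ.* j)) * (Q l * (Q⁻ i * Q j)))
        reindex zero = trans (trans (*-congˡ (zeroˡ _)) (zeroʳ _))
          (sym (trans (*-congˡ (trans (*-congˡ (zeroˡ _)) (zeroʳ _))) (zeroʳ _)))
        reindex (suc m) = trans
          (∑³-Q⁻₁ m n (λ l i j → X (c ℕ.* (suc i ℕ.* j))))
          (sym (∑³-0ᵢ m n (λ l i j → X (c ℕ.* (i ℕ.* j)) * (Q l * (Q⁻ i * Q j)))
            (λ l j → trans (*-congˡ (trans (*-congˡ (zeroˡ _)) (zeroʳ _))) (zeroʳ _))))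
        merge : ∀ l i j →
          X (c ℕ.* (i ℕ.* suc j)) * (Q l * (Q i * Q j)) + X (c ℕ.* (i ℕ.* j)) * (Q l * (Q⁻ i * Q j))
            ≈ durfee l i j
        merge l i j = begin
          X (c ℕ.* (i ℕ.* suc j)) * (Q l * (Q i * Q j)) + e * (Q l * (Q⁻ i * Q j))
            ≈⟨ +-congʳ (*-congʳ (sym (X-*suc i j))) ⟩
          (e * X (c ℕ.* i)) * (Q l * (Q i * Q j)) + e * (Q l * (Q⁻ i * Q j))
            ≈⟨ solve 6 (λ e xi ql qi mi qj →
                 (e :* xi) :* (ql :* (qi :* qj)) :+ e :* (ql :* (mi :* qj))
                 := e :* (ql :* ((mi :+ xi :* qi) :* qj)))
                 refl e (X (c ℕ.* i)) (Q l) (Q i) (Q⁻ i) (Q j) ⟩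
          e * (Q l * ((Q⁻ i + X (c ℕ.* i) * Q i) * Q j))
            ≈⟨ *-congˡ (*-congˡ (*-congʳ (sym (Q-unfold i)))) ⟩
          e * (Q l * (Q i * Q j)) ∎
          where e = X (c ℕ.* (i ℕ.* j))

    -- Divided by `Q m` and read for c = 1, this sorts partitions into at most n parts by their
    -- largest rectangle of j rows and i columns with j - i = n - m. To its right stand at most j
    -- rows, below it a partition in an l by i box.
    ∑³-durfee : ∀ m n → ∑³ m n durfee ≈ Q m * Q n
    ∑³-durfee zero zero = base 0
      where
      base : ∀ m → X (c ℕ.* 0) * (1# * (Q m * 1#)) ≈ Q m * 1#
      base m = trans (*-cong (trans (X-cong (ℕ.*-zeroʳ c)) X-zero) (*-identityˡ _)) (*-identityˡ _)
    ∑³-durfee (suc m) zero = begin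
      X (c ℕ.* (m ℕ.* 0)) * (1# * (Q (suc m) * 1#))
        ≈⟨ *-cong (trans (X-cong (≡.trans (≡.cong (c ℕ.*_) (ℕ.*-zeroʳ m)) (ℕ.*-zeroʳ c))) X-zero) (*-identityˡ _) ⟩
      1# * (Q (suc m) * 1#)
        ≈⟨ *-identityˡ _ ⟩
      Q (suc m) * 1# ∎
    ∑³-durfee m (suc n) = begin
      ∑³ m (suc n) durfee
        ≈⟨ geo-unique (c ℕ.* suc n) {{ℕ.m*n≢0 c (suc n)}} (∑³-durfee-suc m n) ⟩
      geo (c ℕ.* suc n) * ∑³ m n durfee
        ≈⟨ *-congˡ (∑³-durfee m n) ⟩
      geo (c ℕ.* suc n) * (Q m * Q n)
        ≈⟨ solve 3 (λ g a b → g :* (a :* b) := a :* (g :* b)) refl _ _ _ ⟩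
      Q m * Q (suc n) ∎

  -- The q-binomial theorem as a finite triple product

  module Rothe (x y : ℕ) .{{_ : NonZero (x ℕ.+ y)}} where

    private
      c = x ℕ.+ y
    open Base c

    term : ℕ → ℕ → ℕ → Carrier
    term k i j = X (ε x y i k) * (Q i * Q j)

    factors : ℕ → Carrier
    factors zero    = 1#
    factors (suc k) = (1# + X (x ℕ.+ c ℕ.* k)) * ((1# + X (y ℕ.+ c ℕ.* k)) * factors k)

    private
      -- The q-Pascal rule weighted by q^ε and summed. The parameters f, g, h cover its two
      -- orientations: one lowers j plainly and i with a weight, the other is its mirror image. They
      -- insert the factors 1 + q^(x+ca) and 1 + q^(y+ck) respectively.
      collect : ∀ k n (f : ℕ → ℕ → Carrier) (g : ℕ → ℕ → ℕ) (h : ℕ → ℕ → Carrier) →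
        (∀ i j → Q i * Q j ≈ (f i j + X (g i j) * h i j) + X (c ℕ.* (i ℕ.+ j)) * (Q i * Q j)) →
        ∑ n (term k) ≈
        (∑ n (λ i j → X (ε x y i k) * f i j) + ∑ n (λ i j → X (g i j ℕ.+ ε x y i k) * h i j))
          + X (c ℕ.* n) * ∑ n (term k)
      collect k n f g h unfold = begin
        ∑ n (term k)
          ≈⟨ ∑-cong n split ⟩
        ∑ n (λ i j → (X (ε x y i k) * f i j + X (g i j ℕ.+ ε x y i k) * h i j)
                      + X (c ℕ.* n) * term k i j)
          ≈⟨ ∑-distrib-+ n _ _ ⟩
        ∑ n (λ i j → X (ε x y i k) * f i j + X (g i j ℕ.+ ε x y i k) * h i j)
          + ∑ n (λ i j → X (c ℕ.* n) * term k i j)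
          ≈⟨ +-cong (∑-distrib-+ n _ _) (sym (*-distribˡ-∑ n _ (term k))) ⟩
        (∑ n (λ i j → X (ε x y i k) * f i j) + ∑ n (λ i j → X (g i j ℕ.+ ε x y i k) * h i j))
          + X (c ℕ.* n) * ∑ n (term k) ∎
        where
        split : ∀ i j → i ℕ.+ j ≡ n → term k i j ≈
          (X (ε x y i k) * f i j + X (g i j ℕ.+ ε x y i k) * h i j) + X (c ℕ.* n) * term k i j
        split i j ≡.refl = begin
          e * (Q i * Q j)
            ≈⟨ *-congˡ (unfold i j) ⟩
          e * ((f i j + X (g i j) * h i j) + X (c ℕ.* (i ℕ.+ j)) * (Q i * Q j))
            ≈⟨ solve 6 (λ e f g h z q →
                 e :* ((f :+ g :* h) :+ z :* q) := (e :* f :+ (g :* e) :* h) :+ z :* (e :* q))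
                 refl e (f i j) (X (g i j)) (h i j) (X (c ℕ.* (i ℕ.+ j))) (Q i * Q j) ⟩
          (e * f i j + (X (g i j) * e) * h i j) + X (c ℕ.* (i ℕ.+ j)) * (e * (Q i * Q j))
            ≈⟨ +-congʳ (+-congˡ (*-congʳ (sym (X-+ _ _)))) ⟩
          (e * f i j + X (g i j ℕ.+ ε x y i k) * h i j) + X (c ℕ.* (i ℕ.+ j)) * (e * (Q i * Q j)) ∎
          where e = X (ε x y i k)

      assemble : ∀ n e s {F} → F ≈ (s + X e * s) + X (c ℕ.* suc n) * F →
                 F ≈ geo (c ℕ.* suc n) * ((1# + X e) * s)
      assemble n e s F≈ = geo-unique (c ℕ.* suc n) {{ℕ.m*n≢0 c (suc n)}}
        (trans F≈ (+-congʳ (solve 2 (λ s z → s :+ z :* s := (con 1 :+ z) :* s) refl s (X e))))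

    ∑-step-x : ∀ a k → ∑ (suc (a ℕ.+ k)) (term k) ≈
      geo (c ℕ.* suc (a ℕ.+ k)) * ((1# + X (x ℕ.+ c ℕ.* a)) * ∑ (a ℕ.+ k) (term k))
    ∑-step-x a k = assemble n (x ℕ.+ c ℕ.* a) _ (begin
      ∑ (suc n) (term k)
        ≈⟨ collect k (suc n) (λ i j → Q i * Q⁻ j) (λ i j → c ℕ.* j) (λ i j → Q⁻ i * Q j) Q*Q-unfold ⟩
      (∑ (suc n) (λ i j → X (ε x y i k) * (Q i * Q⁻ j))
        + ∑ (suc n) (λ i j → X (c ℕ.* j ℕ.+ ε x y i k) * (Q⁻ i * Q j))) + rest
        ≈⟨ +-congʳ (+-cong
             (∑-Q⁻ʳ n (λ i _ → X (ε x y i k)))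
             (trans (∑-Q⁻ˡ n (λ i j → X (c ℕ.* j ℕ.+ ε x y i k))) (trans (∑-cong n shift) (sym (*-distribˡ-∑ n _ (term k)))))) ⟩
      (∑ n (term k) + X (x ℕ.+ c ℕ.* a) * ∑ n (term k)) + rest ∎)
      where
      n = a ℕ.+ k
      rest = X (c ℕ.* suc n) * ∑ (suc n) (term k)
      shift : ∀ i j → i ℕ.+ j ≡ n →
        X (c ℕ.* j ℕ.+ ε x y (suc i) k) * (Q i * Q j) ≈ X (x ℕ.+ c ℕ.* a) * term k i j
      shift i j eq = trans (*-congʳ (trans (X-cong (ε-step-x x y i j k a eq)) (X-+ _ _))) (*-assoc _ _ _)

    ∑-step-y : ∀ n k → ∑ (suc n) (term (suc k)) ≈
      geo (c ℕ.* suc n) * ((1# + X (y ℕ.+ c ℕ.* k)) * ∑ n (term k))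
    ∑-step-y n k = assemble n (y ℕ.+ c ℕ.* k) _ (begin
      ∑ (suc n) (term (suc k))
        ≈⟨ collect (suc k) (suc n) (λ i j → Q⁻ i * Q j) (λ i j → c ℕ.* i) (λ i j → Q i * Q⁻ j) unfold ⟩
      (∑ (suc n) (λ i j → X (ε x y i (suc k)) * (Q⁻ i * Q j))
        + ∑ (suc n) (λ i j → X (c ℕ.* i ℕ.+ ε x y i (suc k)) * (Q i * Q⁻ j))) + rest
        ≈⟨ +-congʳ (+-cong
             (∑-Q⁻ˡ n (λ i _ → X (ε x y i (suc k))))
             (trans (∑-Q⁻ʳ n (λ i j → X (c ℕ.* i ℕ.+ ε x y i (suc k)))) (trans (∑-cong n shift) (sym (*-distribˡ-∑ n _ (term k)))))) ⟩
      (∑ n (term k) + X (y ℕ.+ c ℕ.* k) * ∑ n (term k)) + rest ∎)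
      where
      rest = X (c ℕ.* suc n) * ∑ (suc n) (term (suc k))
      unfold : ∀ i j → Q i * Q j ≈
        (Q⁻ i * Q j + X (c ℕ.* i) * (Q i * Q⁻ j)) + X (c ℕ.* (i ℕ.+ j)) * (Q i * Q j)
      unfold i j = begin
        Q i * Q j
          ≈⟨ *-comm _ _ ⟩
        Q j * Q i
          ≈⟨ Q*Q-unfold j i ⟩
        (Q j * Q⁻ i + X (c ℕ.* i) * (Q⁻ j * Q i)) + X (c ℕ.* (j ℕ.+ i)) * (Q j * Q i)
          ≈⟨ +-cong (+-cong (*-comm _ _) (*-congˡ (*-comm _ _)))
               (*-cong (X-cong (≡.cong (c ℕ.*_) (ℕ.+-comm j i))) (*-comm _ _)) ⟩
        (Q⁻ i * Q j + X (c ℕ.* i) * (Q i * Q⁻ j)) + X (c ℕ.* (i ℕ.+ j)) * (Q i * Q j) ∎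
      shift : ∀ i j → i ℕ.+ j ≡ n →
        X (c ℕ.* i ℕ.+ ε x y i (suc k)) * (Q i * Q j) ≈ X (y ℕ.+ c ℕ.* k) * term k i j
      shift i j _ = trans (*-congʳ (trans (X-cong (ε-step-y x y i k)) (X-+ _ _))) (*-assoc _ _ _)

    -- The product grows by one factor of each kind in turn. `∑-step-x` raises i + j by 1;
    -- `∑-step-y` does so too and also shifts the origin of r, so that the sum is again centred at r
    -- = 0.
    rothe : ∀ k → ∑ (double k) (term k) ≈ factors k * Q (double k)
    rothe zero = begin
      X (x ℕ.* 0 ℕ.+ c ℕ.* 0) * (1# * 1#)
        ≈⟨ *-cong (trans (X-cong (≡.cong₂ ℕ._+_ (ℕ.*-zeroʳ x) (ℕ.*-zeroʳ c))) X-zero) (*-identityˡ 1#) ⟩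
      1# * 1# ∎
    rothe (suc k) = begin
      ∑ (suc (suc (double k))) (term (suc k))
        ≈⟨ ∑-step-y (suc (double k)) k ⟩
      g₂ * (b * ∑ (suc (double k)) (term k))
        ≈⟨ *-congˡ (*-congˡ (≡.subst
             (λ n → ∑ (suc n) (term k) ≈ geo (c ℕ.* suc n) * (a * ∑ n (term k)))
             (≡.sym (double≡n+n k)) (∑-step-x k k))) ⟩
      g₂ * (b * (g₁ * (a * ∑ (double k) (term k))))
        ≈⟨ *-congˡ (*-congˡ (*-congˡ (*-congˡ (rothe k)))) ⟩
      g₂ * (b * (g₁ * (a * (factors k * Q (double k)))))
        ≈⟨ solve 6 (λ g₂ b g₁ a p q → g₂ :* (b :* (g₁ :* (a :* (p :* q)))) := (a :* (b :* p)) :* (g₂ :* (g₁ :* q)))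
             refl g₂ b g₁ a (factors k) (Q (double k)) ⟩
      factors (suc k) * Q (double (suc k)) ∎
      where
      g₂ = geo (c ℕ.* suc (suc (double k)))
      g₁ = geo (c ℕ.* suc (double k))
      a = 1# + X (x ℕ.+ c ℕ.* k)
      b = 1# + X (y ℕ.+ c ℕ.* k)

  open Base 1
  module R₁ = Rothe 1 0
  module R₃ = Rothe 2 1

  -- The Bailey step. Adding l to both i and n leaves r unchanged, so q^(r(3r+1)/2) depends only on
  -- the outer index l + i and leaves the sum over l; `∑³-durfee` evaluates what remains.
  ∑-R₁-term : ∀ N →
    ∑ N (λ l n → Q l * (X (n ℕ.* n) * (R₁.factors n * Q (double n))))
      ≈ ∑ (double N) (λ i j → X (ε 2 1 i N) * (Q i * Q j))
  ∑-R₁-term N = begin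
    ∑ N (λ l n → Q l * (X (n ℕ.* n) * (R₁.factors n * Q (double n))))
      ≈⟨ ∑-cong N expand ⟩
    ∑ N (λ l n → ∑ (double n) (λ i j → X (ε 2 1 (l ℕ.+ i) N) * durfee l i j))
      ≈⟨ ∑-∑³ N (λ l i j → X (ε 2 1 (l ℕ.+ i) N) * durfee l i j) ⟨
    ∑ (double N) (λ m n → ∑³ m n (λ l i j → X (ε 2 1 (l ℕ.+ i) N) * durfee l i j))
      ≈⟨ ∑-cong (double N) (λ m n _ → collapse m n) ⟩
    ∑ (double N) (λ m n → X (ε 2 1 m N) * (Q m * Q n)) ∎
    where
    collapse : ∀ m n → ∑³ m n (λ l i j → X (ε 2 1 (l ℕ.+ i) N) * durfee l i j) ≈ X (ε 2 1 m N) * (Q m * Q n)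
    collapse m n = begin
      ∑³ m n (λ l i j → X (ε 2 1 (l ℕ.+ i) N) * durfee l i j)
        ≈⟨ ∑³-cong m n (λ l i j l+i≡m _ → *-congʳ (X-cong (≡.cong (λ m → ε 2 1 m N) l+i≡m))) ⟩
      ∑³ m n (λ l i j → X (ε 2 1 m N) * durfee l i j)
        ≈⟨ *-distribˡ-∑³ m n _ durfee ⟨
      X (ε 2 1 m N) * ∑³ m n durfee
        ≈⟨ *-congˡ (∑³-durfee m n) ⟩
      X (ε 2 1 m N) * (Q m * Q n) ∎
    expand : ∀ l n → l ℕ.+ n ≡ N → Q l * (X (n ℕ.* n) * (R₁.factors n * Q (double n)))
               ≈ ∑ (double n) (λ i j → X (ε 2 1 (l ℕ.+ i) N) * durfee l i j)
    expand l n ≡.refl = begin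
      Q l * (X (n ℕ.* n) * (R₁.factors n * Q (double n)))
        ≈⟨ *-congˡ (*-congˡ (R₁.rothe n)) ⟨
      Q l * (X (n ℕ.* n) * ∑ (double n) (R₁.term n))
        ≈⟨ *-assoc _ _ _ ⟨
      (Q l * X (n ℕ.* n)) * ∑ (double n) (R₁.term n)
        ≈⟨ *-distribˡ-∑ (double n) _ (R₁.term n) ⟩
      ∑ (double n) (λ i j → (Q l * X (n ℕ.* n)) * R₁.term n i j)
        ≈⟨ ∑-cong (double n) (λ i j i+j≡2n → begin
             (Q l * X (n ℕ.* n)) * (X (ε 1 0 i n) * (Q i * Q j))
               ≈⟨ solve 4 (λ q x e r → (q :* x) :* (e :* r) := (x :* e) :* (q :* r)) refl _ _ _ _ ⟩
             (X (n ℕ.* n) * X (ε 1 0 i n)) * (Q l * (Q i * Q j))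
               ≈⟨ *-congʳ (begin
                    X (n ℕ.* n) * X (ε 1 0 i n)
                      ≈⟨ X-+ _ _ ⟨
                    X (n ℕ.* n ℕ.+ ε 1 0 i n)
                      ≈⟨ X-cong (ε₁-ε₃ i j n (≡.trans i+j≡2n (double≡n+n n))) ⟩
                    X (ε 2 1 i n ℕ.+ i ℕ.* j)
                      ≈⟨ X-cong (≡.cong₂ ℕ._+_ (≡.sym (ε-+ 2 1 i n l)) (≡.sym (ℕ.*-identityˡ (i ℕ.* j)))) ⟩
                    X (ε 2 1 (l ℕ.+ i) (l ℕ.+ n) ℕ.+ 1 ℕ.* (i ℕ.* j))
                      ≈⟨ X-+ _ _ ⟩
                    X (ε 2 1 (l ℕ.+ i) (l ℕ.+ n)) * X (1 ℕ.* (i ℕ.* j)) ∎) ⟩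
             (X (ε 2 1 (l ℕ.+ i) (l ℕ.+ n)) * X (1 ℕ.* (i ℕ.* j))) * (Q l * (Q i * Q j))
               ≈⟨ *-assoc _ _ _ ⟩
             X (ε 2 1 (l ℕ.+ i) (l ℕ.+ n)) * durfee l i j ∎) ⟩
      ∑ (double n) (λ i j → X (ε 2 1 (l ℕ.+ i) (l ℕ.+ n)) * durfee l i j) ∎

-- Power series over ℕ

open import Data.Nat using (_+_; _*_; _∸_)
open import Relation.Binary.PropositionalEquality hiding (J)
open +-*-Solver using (solve; _:+_; _:*_; _:=_; con)

Series : Set
Series = ℕ → ℕ

infixl 6 _⊕_
_⊕_ : Series → Series → Series
(f ⊕ g) n = f n + g n

infixl 7 _⊛_
-- With this form of the Cauchy product, a factor `q^ (suc d)` computes to a shift of the product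
-- with `q^ d`, so many facts about monomials hold by plain recursion.
_⊛_ : Series → Series → Series
(f ⊛ g) zero    = f 0 * g 0
(f ⊛ g) (suc n) = f 0 * g (suc n) + ((f ∘ suc) ⊛ g) n

q^ : ℕ → Series
q^ zero    zero    = 1
q^ zero    (suc n) = 0
q^ (suc d) zero    = 0
q^ (suc d) (suc n) = q^ d n

⊛-cong-≤ : ∀ {f f′ g g′} n → (∀ {i} → i ≤ n → f i ≡ f′ i) → (∀ {i} → i ≤ n → g i ≡ g′ i) →
           (f ⊛ g) n ≡ (f′ ⊛ g′) n
⊛-cong-≤ zero    f≡ g≡ = cong₂ _*_ (f≡ z≤n) (g≡ z≤n)
⊛-cong-≤ (suc n) f≡ g≡ = cong₂ _+_ (cong₂ _*_ (f≡ z≤n) (g≡ ℕ.≤-refl))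
  (⊛-cong-≤ n (λ i≤n → f≡ (s≤s i≤n)) (λ i≤n → g≡ (ℕ.m≤n⇒m≤1+n i≤n)))

⊛-distribʳ : ∀ h f g → (f ⊕ g) ⊛ h ≗ f ⊛ h ⊕ g ⊛ h
⊛-distribʳ h f g zero    = ℕ.*-distribʳ-+ (h 0) (f 0) (g 0)
⊛-distribʳ h f g (suc n) = trans
  (cong ((f 0 + g 0) * h (suc n) +_) (⊛-distribʳ h (f ∘ suc) (g ∘ suc) n))
  (solve 5 (λ f g h a b → (f :+ g) :* h :+ (a :+ b) := (f :* h :+ a) :+ (g :* h :+ b))
    refl (f 0) (g 0) (h (suc n)) _ _)

⊛-scaleˡ : ∀ a f g → (λ n → a * f n) ⊛ g ≗ λ n → a * (f ⊛ g) n
⊛-scaleˡ a f g zero    = ℕ.*-assoc a (f 0) (g 0)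
⊛-scaleˡ a f g (suc n) = trans
  (cong (a * f 0 * g (suc n) +_) (⊛-scaleˡ a (f ∘ suc) g n))
  (solve 4 (λ a f g h → a :* f :* g :+ a :* h := a :* (f :* g :+ h)) refl a (f 0) (g (suc n)) _)

⊛-sucʳ : ∀ f g n → (f ⊛ g) (suc n) ≡ f (suc n) * g 0 + (f ⊛ (g ∘ suc)) n
⊛-sucʳ f g zero    = ℕ.+-comm (f 0 * g 1) (f 1 * g 0)
⊛-sucʳ f g (suc n) = trans
  (cong (f 0 * g (suc (suc n)) +_) (⊛-sucʳ (f ∘ suc) g n))
  (solve 3 (λ a b c → a :+ (b :+ c) := b :+ (a :+ c)) 
    refl (f 0 * g (suc (suc n))) (f (suc (suc n)) * g 0) (((f ∘ suc) ⊛ (g ∘ suc)) n))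

⊛-comm : ∀ f g → f ⊛ g ≗ g ⊛ f
⊛-comm f g zero    = ℕ.*-comm (f 0) (g 0)
⊛-comm f g (suc n) = trans
  (cong₂ _+_ (ℕ.*-comm (f 0) (g (suc n))) (⊛-comm (f ∘ suc) g n))
  (sym (⊛-sucʳ g f n))

⊛-assoc : ∀ f g h → (f ⊛ g) ⊛ h ≗ f ⊛ (g ⊛ h)
⊛-assoc f g h zero    = ℕ.*-assoc (f 0) (g 0) (h 0)
⊛-assoc f g h (suc n) = begin
  f 0 * g 0 * h (suc n) + (((λ n → f 0 * g (suc n)) ⊕ (f ∘ suc) ⊛ g) ⊛ h) n
    ≡⟨ cong (f 0 * g 0 * h (suc n) +_) (⊛-distribʳ h (λ n → f 0 * g (suc n)) ((f ∘ suc) ⊛ g) n) ⟩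
  f 0 * g 0 * h (suc n) + (((λ n → f 0 * g (suc n)) ⊛ h) n + (((f ∘ suc) ⊛ g) ⊛ h) n)
    ≡⟨ cong (f 0 * g 0 * h (suc n) +_) (cong₂ _+_ (⊛-scaleˡ (f 0) (g ∘ suc) h n) (⊛-assoc (f ∘ suc) g h n)) ⟩
  f 0 * g 0 * h (suc n) + (f 0 * ((g ∘ suc) ⊛ h) n + ((f ∘ suc) ⊛ (g ⊛ h)) n)
    ≡⟨ solve 5 (λ f g h a b → f :* g :* h :+ (f :* a :+ b) := f :* (g :* h :+ a) :+ b) refl (f 0) (g 0) (h (suc n)) _ _ ⟩
  f 0 * (g ⊛ h) (suc n) + ((f ∘ suc) ⊛ (g ⊛ h)) n ∎
  where open ≡-Reasoning

⊛-zeroˡ : ∀ f → const 0 ⊛ f ≗ const 0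
⊛-zeroˡ f zero    = refl
⊛-zeroˡ f (suc n) = ⊛-zeroˡ f n

⊛-identityˡ : ∀ f → q^ 0 ⊛ f ≗ f
⊛-identityˡ f zero    = ℕ.*-identityˡ (f 0)
⊛-identityˡ f (suc n) = trans (cong₂ _+_ (ℕ.*-identityˡ (f (suc n))) (⊛-zeroˡ f n)) (ℕ.+-identityʳ _)

seriesSemiring : CommutativeSemiring 0ℓ 0ℓ
seriesSemiring = record
  { Carrier = Series
  ; _≈_ = _≗_
  ; _+_ = _⊕_
  ; _*_ = _⊛_
  ; 0# = const 0
  ; 1# = q^ 0
  ; isCommutativeSemiring = isCommutativeSemiringˡ record
    { +-isCommutativeMonoid = record
      { isMonoid = record
        { isSemigroup = record
          { isMagma = record
            { isEquivalence = Setoid.isEquivalence (ℕ →-setoid ℕ)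
            ; ∙-cong = λ f≗ g≗ n → cong₂ _+_ (f≗ n) (g≗ n)
            }
          ; assoc = λ f g h n → ℕ.+-assoc (f n) (g n) (h n)
          }
        ; identity = (λ f n → refl) , λ f n → ℕ.+-identityʳ (f n)
        }
      ; comm = λ f g n → ℕ.+-comm (f n) (g n)
      }
    ; *-isCommutativeMonoid = record
      { isMonoid = record
        { isSemigroup = record
          { isMagma = record { isEquivalence = Setoid.isEquivalence (ℕ →-setoid ℕ) ; ∙-cong = λ f≗ g≗ n → ⊛-cong-≤ n (λ {i} _ → f≗ i) (λ {i} _ → g≗ i) }
          ; assoc = ⊛-assoc
          }
        ; identity = ⊛-identityˡ , λ f n → trans (⊛-comm f (q^ 0) n) (⊛-identityˡ f n)
        }
      ; comm = ⊛-comm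
      }
    ; distribʳ = ⊛-distribʳ
    ; zeroˡ = ⊛-zeroˡ
    }
  }

q^-⊛-+ : ∀ d f n → (q^ d ⊛ f) (d + n) ≡ f n
q^-⊛-+ zero    f n = ⊛-identityˡ f n
q^-⊛-+ (suc d) f n = q^-⊛-+ d f n

q^-⊛-< : ∀ {d n} f → n < d → (q^ d ⊛ f) n ≡ 0
q^-⊛-< {n = zero}  f (s≤s n<d) = refl
q^-⊛-< {n = suc n} f (s≤s n<d) = q^-⊛-< f n<d

q^-+ : ∀ d e → q^ (d + e) ≗ q^ d ⊛ q^ e
q^-+ zero    e n       = sym (⊛-identityˡ (q^ e) n)
q^-+ (suc d) e zero    = refl
q^-+ (suc d) e (suc n) = q^-+ d e n

-- periodic c r has coefficient 1 exactly at the n ≡ r mod c + 1, for r ≤ c.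
periodic : ℕ → ℕ → Series
periodic c zero    zero    = 1
periodic c zero    (suc n) = periodic c c n
periodic c (suc r) zero    = 0
periodic c (suc r) (suc n) = periodic c r n

periodic-q^ : ∀ c r → periodic c r ≗ q^ r ⊛ periodic c 0
periodic-q^ c zero    n       = sym (⊛-identityˡ _ n)
periodic-q^ c (suc r) zero    = refl
periodic-q^ c (suc r) (suc n) = periodic-q^ c r n

-- 1 / (1 − q ^ d), with the junk value 0 at d = 0.
geometric : ℕ → Series
geometric zero    = const 0
geometric (suc c) = periodic c 0

geometric-unfold : ∀ d .{{_ : NonZero d}} → geometric d ≗ q^ 0 ⊕ q^ d ⊛ geometric d
geometric-unfold (suc c) zero    = refl
geometric-unfold (suc c) (suc n) = periodic-q^ c c n

series-hasGeometricSeries : HasGeometricSeries seriesSemiring q^ geometric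
series-hasGeometricSeries = record
  { +-cancelˡ  = λ f eq n → ℕ.+-cancelˡ-≡ (f n) _ _ (eq n)
  ; X-zero     = λ _ → refl
  ; X-+        = q^-+
  ; geo-unfold = geometric-unfold
  }

open QSeries seriesSemiring q^ geometric series-hasGeometricSeries
module 𝕊 = CommutativeSemiring seriesSemiring

geometric-⊛ : ∀ d .{{_ : NonZero d}} f → geometric d ⊛ f ≗ f ⊕ q^ d ⊛ (geometric d ⊛ f)
geometric-⊛ d f n = begin
  (geometric d ⊛ f) n
    ≡⟨ 𝕊.*-congʳ {f} (geometric-unfold d) n ⟩
  ((q^ 0 ⊕ q^ d ⊛ geometric d) ⊛ f) n
    ≡⟨ ⊛-distribʳ f (q^ 0) (q^ d ⊛ geometric d) n ⟩
  (q^ 0 ⊛ f) n + ((q^ d ⊛ geometric d) ⊛ f) n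
    ≡⟨ cong₂ _+_ (⊛-identityˡ f n) (⊛-assoc (q^ d) (geometric d) f n) ⟩
  f n + (q^ d ⊛ (geometric d ⊛ f)) n ∎
  where open ≡-Reasoning

-- Congruence modulo q^(N + 1)

infix 4 _≈⟦_⟧_
record _≈⟦_⟧_ (f : Series) (N : ℕ) (g : Series) : Set where
  constructor upTo
  field coeff : ∀ {n} → n ≤ N → f n ≡ g n
open _≈⟦_⟧_

truncated : ℕ → Setoid 0ℓ 0ℓ
truncated N = record
  { Carrier = Series
  ; _≈_ = _≈⟦ N ⟧_
  ; isEquivalence = record
    { refl  = upTo (λ _ → refl)
    ; sym   = λ f≈g → upTo (λ n≤N → sym (coeff f≈g n≤N))
    ; trans = λ f≈g g≈h → upTo (λ n≤N → trans (coeff f≈g n≤N) (coeff g≈h n≤N))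
    }
  }

module _ {N : ℕ} where

  open Setoid (truncated N) using () renaming (refl to ≈-refl)

  exact : ∀ {f g} → f ≗ g → f ≈⟦ N ⟧ g
  exact f≗g = upTo (λ {n} _ → f≗g n)

  ⊕-cong-trunc : ∀ {f f′ g g′} → f ≈⟦ N ⟧ f′ → g ≈⟦ N ⟧ g′ → f ⊕ g ≈⟦ N ⟧ f′ ⊕ g′
  ⊕-cong-trunc f≈ g≈ = upTo (λ n≤N → cong₂ _+_ (coeff f≈ n≤N) (coeff g≈ n≤N))

  ⊛-cong-trunc : ∀ {f f′ g g′} → f ≈⟦ N ⟧ f′ → g ≈⟦ N ⟧ g′ → f ⊛ g ≈⟦ N ⟧ f′ ⊛ g′
  ⊛-cong-trunc f≈ g≈ = upTo λ {n} n≤N → ⊛-cong-≤ n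
    (λ i≤n → coeff f≈ (ℕ.≤-trans i≤n n≤N)) (λ i≤n → coeff g≈ (ℕ.≤-trans i≤n n≤N))

  -- A factor q^d gains d orders of precision. This pays for every exchange of one truncated product
  -- for another below.
  q^-⊛-trunc : ∀ {k f g} d → N ≤ d + k → f ≈⟦ k ⟧ g → q^ d ⊛ f ≈⟦ N ⟧ q^ d ⊛ g
  q^-⊛-trunc {k} {f} {g} d N≤d+k f≈g = upTo λ {n} n≤N → go d (ℕ.≤-trans n≤N N≤d+k)
    where
    go : ∀ d {n} → n ≤ d + k → (q^ d ⊛ f) n ≡ (q^ d ⊛ g) n
    go zero    n≤k     = trans (⊛-identityˡ f _) (trans (coeff f≈g n≤k) (sym (⊛-identityˡ g _)))
    go (suc d) z≤n     = refl
    go (suc d) (s≤s p) = go d p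

  -- Read f = (1 - q^d) · (`geometric d ⊛ f`) additively: the terms to be subtracted agree up to
  -- degree N by hypothesis.
  geometric-cancel : ∀ d .{{_ : NonZero d}} {f g} →
    geometric d ⊛ f ≈⟦ N ⟧ geometric d ⊛ g → f ≈⟦ N ⟧ g
  geometric-cancel d {f} {g} eq = upTo λ {n} n≤N →
    ℕ.+-cancelʳ-≡ ((q^ d ⊛ (geometric d ⊛ f)) n) _ _ (begin
      f n + (q^ d ⊛ (geometric d ⊛ f)) n
        ≡⟨ geometric-⊛ d f n ⟨
      (geometric d ⊛ f) n
        ≡⟨ coeff eq n≤N ⟩
      (geometric d ⊛ g) n
        ≡⟨ geometric-⊛ d g n ⟩
      g n + (q^ d ⊛ (geometric d ⊛ g)) n
        ≡⟨ cong (g n +_) (coeff (⊛-cong-trunc (≈-refl {q^ d}) eq) n≤N) ⟨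
      g n + (q^ d ⊛ (geometric d ⊛ f)) n ∎)
    where open ≡-Reasoning

  ∑-cong-trunc : ∀ n {f g : ℕ → ℕ → Series} → (∀ i j → i + j ≡ n → f i j ≈⟦ N ⟧ g i j) →
    ∑ n f ≈⟦ N ⟧ ∑ n g
  ∑-cong-trunc zero    f≈g = f≈g 0 0 refl
  ∑-cong-trunc (suc n) f≈g = ⊕-cong-trunc (f≈g 0 (suc n) refl)
    (∑-cong-trunc n (λ i j i+j≡n → f≈g (suc i) j (cong suc i+j≡n)))

module Stable (c : ℕ) .{{_ : NonZero c}} where

  open Base c

  -- The extra factors 1 / (1 - q^(ci)) have ci > k, so they are 1 modulo q^(k+1).
  Q-stable-+ : ∀ k d → Q (d + k) ≈⟦ k ⟧ Q k
  Q-stable-+ k zero    = upTo (λ _ → refl)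
  Q-stable-+ k (suc d) = upTo λ {i} i≤k → begin
    Q (suc d + k) i
      ≡⟨ Q-unfold (suc d + k) i ⟩
    Q (d + k) i + (q^ (c * suc (d + k)) ⊛ Q (suc d + k)) i
      ≡⟨ cong (Q (d + k) i +_) (q^-⊛-< (Q (suc d + k)) (i< i≤k)) ⟩
    Q (d + k) i + 0
      ≡⟨ ℕ.+-identityʳ _ ⟩
    Q (d + k) i
      ≡⟨ coeff (Q-stable-+ k d) i≤k ⟩
    Q k i ∎
    where
    open ≡-Reasoning
    i< : ∀ {i} → i ≤ k → i < c * suc (d + k)
    i< i≤k = ℕ.≤-trans (s≤s (ℕ.≤-trans i≤k (ℕ.m≤n+m k d))) (ℕ.m≤n*m (suc (d + k)) c)

  Q-stable : ∀ {k m n} → k ≤ m → k ≤ n → Q m ≈⟦ k ⟧ Q n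
  Q-stable {k} {m} {n} k≤m k≤n = upTo λ i≤k → begin
    Q m _             ≡⟨ cong (λ m → Q m _) (ℕ.m∸n+n≡m k≤m) ⟨
    Q (m ∸ k + k) _ ≡⟨ coeff (Q-stable-+ k (m ∸ k)) i≤k ⟩
    Q k _             ≡⟨ coeff (Q-stable-+ k (n ∸ k)) i≤k ⟨
    Q (n ∸ k + k) _ ≡⟨ cong (λ n → Q n _) (ℕ.m∸n+n≡m k≤n) ⟩
    Q n _             ∎
    where open ≡-Reasoning

  Q-cancel : ∀ {N f g} n → Q n ⊛ f ≈⟦ N ⟧ Q n ⊛ g → f ≈⟦ N ⟧ g
  Q-cancel {N} {f} {g} zero    eq = begin
    f            ≈⟨ exact (⊛-identityˡ f) ⟨
    q^ 0 ⊛ f     ≈⟨ eq ⟩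
    q^ 0 ⊛ g     ≈⟨ exact (⊛-identityˡ g) ⟩
    g            ∎
    where open import Relation.Binary.Reasoning.Setoid (truncated N)
  Q-cancel {N} {f} {g} (suc n) eq = Q-cancel n (geometric-cancel d {{ℕ.m*n≢0 c (suc n)}} (begin
    geometric d ⊛ (Q n ⊛ f)   ≈⟨ exact (⊛-assoc (geometric d) (Q n) f) ⟨
    (geometric d ⊛ Q n) ⊛ f   ≈⟨ eq ⟩
    (geometric d ⊛ Q n) ⊛ g   ≈⟨ exact (⊛-assoc (geometric d) (Q n) g) ⟩
    geometric d ⊛ (Q n ⊛ g)   ∎))
    where
    open import Relation.Binary.Reasoning.Setoid (truncated N)
    d = c * suc n

-- Together with `ε-boundʳ` this says |r| ≤ r(3r + 1)/2, which is tight at r = -1.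
ε-boundˡ : ∀ i k → k ≤ ε 2 1 i k + i
ε-boundˡ i       zero    = z≤n
ε-boundˡ zero    (suc k) = ℕ.≤-trans (ℕ.≤-reflexive (sym (ℕ.*-identityˡ (suc k))))
                             (ℕ.≤-trans (ℕ.m≤m+n (1 * suc k) _) (ℕ.m≤m+n _ 0))
ε-boundˡ (suc i) (suc k) = ℕ.≤-trans (s≤s (ε-boundˡ i k)) (ℕ.≤-reflexive (sym (ℕ.+-suc _ i)))

ε-boundʳ : ∀ i k → i ≤ ε 2 1 i k + k
ε-boundʳ i       zero    = ℕ.≤-trans (ℕ.m≤n*m i 2) (ℕ.≤-trans (ℕ.m≤m+n (2 * i) _) (ℕ.m≤m+n _ 0))
ε-boundʳ zero    (suc k) = z≤n
ε-boundʳ (suc i) (suc k) = ℕ.≤-trans (s≤s (ε-boundʳ i k)) (ℕ.≤-reflexive (sym (ℕ.+-suc _ k)))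

smaller-half : ∀ {i j N} → i + j ≡ N + N → i ≤ j → i ≤ N
smaller-half {i} {j} {N} i+j≡2N i≤j = ℕ.≮⇒≥ λ N<i →
  ℕ.<-irrefl (sym i+j≡2N) (ℕ.+-mono-< N<i (ℕ.<-≤-trans N<i i≤j))

-- q^(ε r) vanishes to an order that makes up for replacing the two truncated
-- products 1 / (q)_{N ± r} by 1 / (q)_N.
module Theta (c : ℕ) .{{_ : NonZero c}} (N : ℕ) where

  open Base c
  open Stable c

  -- The part -N ≤ r ≤ N of A. The base c does not occur in it, so bases 1 and 3 give the same
  -- series, through which J and L are compared.
  theta : Series
  theta = ∑ (double N) (λ i j → q^ (ε 2 1 i N))

  private
    -- The witness is the smaller index, N - |r|; the inequality |r| ≤ ε covers the missing |r|
    -- degrees.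
    min-bound : ∀ i j → i + j ≡ N + N → ∃ λ k → k ≤ i × k ≤ j × k ≤ N × N ≤ ε 2 1 i N + k
    min-bound i j eq with ℕ.≤-total i j
    ... | inj₁ i≤j = i , ℕ.≤-refl , i≤j , smaller-half eq i≤j , ε-boundˡ i N
    ... | inj₂ j≤i = j , j≤i , ℕ.≤-refl , smaller-half (trans (ℕ.+-comm j i) eq) j≤i ,
      ℕ.+-cancelʳ-≤ N N _ (begin
        N + N                    ≡⟨ eq ⟨
        i + j                    ≤⟨ ℕ.+-monoˡ-≤ j (ε-boundʳ i N) ⟩
        ε 2 1 i N + N + j        ≡⟨ solve 3 (λ e N j → e :+ N :+ j := e :+ j :+ N) refl (ε 2 1 i N) N j ⟩
        ε 2 1 i N + j + N        ∎)
      where open ℕ.≤-Reasoning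

    stabilise : ∀ i j → i + j ≡ double N →
      q^ (ε 2 1 i N) ⊛ (Q i ⊛ Q j) ≈⟦ N ⟧ (Q N ⊛ Q N) ⊛ q^ (ε 2 1 i N)
    stabilise i j eq with min-bound i j (trans eq (double≡n+n N))
    ... | k , k≤i , k≤j , k≤N , N≤ε+k = begin
      q^ (ε 2 1 i N) ⊛ (Q i ⊛ Q j)
        ≈⟨ q^-⊛-trunc (ε 2 1 i N) N≤ε+k (⊛-cong-trunc (Q-stable k≤i k≤N) (Q-stable k≤j k≤N)) ⟩
      q^ (ε 2 1 i N) ⊛ (Q N ⊛ Q N)
        ≈⟨ exact (⊛-comm (q^ (ε 2 1 i N)) (Q N ⊛ Q N)) ⟩
      (Q N ⊛ Q N) ⊛ q^ (ε 2 1 i N) ∎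
      where open import Relation.Binary.Reasoning.Setoid (truncated N)

  ∑-stable : ∑ (double N) (λ i j → q^ (ε 2 1 i N) ⊛ (Q i ⊛ Q j)) ≈⟦ N ⟧ Q N ⊛ (Q N ⊛ theta)
  ∑-stable = begin
    ∑ (double N) (λ i j → q^ (ε 2 1 i N) ⊛ (Q i ⊛ Q j))
      ≈⟨ ∑-cong-trunc (double N) stabilise ⟩
    ∑ (double N) (λ i j → (Q N ⊛ Q N) ⊛ q^ (ε 2 1 i N))
      ≈⟨ exact (*-distribˡ-∑ (double N) (Q N ⊛ Q N) (λ i j → q^ (ε 2 1 i N))) ⟨
    (Q N ⊛ Q N) ⊛ theta
      ≈⟨ exact (⊛-assoc (Q N) (Q N) theta) ⟩
    Q N ⊛ (Q N ⊛ theta) ∎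
    where open import Relation.Binary.Reasoning.Setoid (truncated N)

-- The generating functions of J and L agree

module B₁ = Base 1
module B₃ = Base 3

overlinedGeometric : ℕ → Series
overlinedGeometric d = (q^ 0 ⊕ q^ d) ⊛ geometric d

J-series : ℕ → Series
J-series zero    = q^ 0
J-series (suc k) = J-series k ⊛ (overlinedGeometric (1 + 3 * k) ⊛ overlinedGeometric (2 + 3 * k))

-- This is q^(n²) (-q)ₙ (-1)ₙ / (q)_{2n}, the shape that `rothe` delivers. Cancelling (-q)ₙ by
-- (q)_{2n} = (q)ₙ (-q)ₙ (q ; q²)ₙ gives the formula of the overview.
L-term : ℕ → Series
L-term n = q^ (n * n) ⊛ (R₁.factors n ⊛ B₁.Q (double n))

L-series : ℕ → Series
L-series N = ∑ N (λ _ n → L-term n)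

-- The common part of `J-series k` and 1 / (q)_{3k}: the factors 1 / (1 - q^i) with i < 3k prime to
-- 3.
coprime : ℕ → Series
coprime zero    = q^ 0
coprime (suc k) = (geometric (1 + 3 * k) ⊛ geometric (2 + 3 * k)) ⊛ coprime k

open import Algebra.Solver.Ring.NaturalCoefficients.Default seriesSemiring using ()
  renaming (solve to solve𝕊; _:+_ to _⊕′_; _:*_ to _⊛′_; _:=_ to _≗′_; con to con𝕊)

J-series-factors : ∀ k → J-series k ≗ coprime k ⊛ R₃.factors k
J-series-factors zero    n = sym (⊛-identityˡ (q^ 0) n)
J-series-factors (suc k) = 𝕊.trans
  (𝕊.*-congʳ {overlinedGeometric (1 + 3 * k) ⊛ overlinedGeometric (2 + 3 * k)} (J-series-factors k))
  (solve𝕊 6 (λ r f a g b h →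
    (r ⊛′ f) ⊛′ ((a ⊛′ g) ⊛′ (b ⊛′ h))
    ≗′ ((g ⊛′ h) ⊛′ r) ⊛′ (b ⊛′ (a ⊛′ f)))
    (λ _ → refl) (coprime k) (R₃.factors k)
    (q^ 0 ⊕ q^ (1 + 3 * k)) (geometric (1 + 3 * k)) (q^ 0 ⊕ q^ (2 + 3 * k)) (geometric (2 + 3 * k)))

Q-coprime : ∀ k → B₁.Q (3 * k) ≗ coprime k ⊛ B₃.Q k
Q-coprime zero    n = sym (⊛-identityˡ (q^ 0) n)
Q-coprime (suc k) = begin
  B₁.Q (3 * suc k)
    ≡⟨ cong B₁.Q (ℕ.*-suc 3 k) ⟩
  geometric (1 * (3 + 3 * k)) ⊛ (geometric (1 * (2 + 3 * k)) ⊛ (geometric (1 * (1 + 3 * k)) ⊛ B₁.Q (3 * k)))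
    ≈⟨ 𝕊.*-cong (geometric≡ (trans (ℕ.*-identityˡ _) (sym (ℕ.*-suc 3 k))))
         (𝕊.*-cong (geometric≡ (ℕ.*-identityˡ (2 + 3 * k))) (𝕊.*-cong (geometric≡ (ℕ.*-identityˡ (1 + 3 * k))) (Q-coprime k))) ⟩
  geometric (3 * suc k) ⊛ (geometric (2 + 3 * k) ⊛ (geometric (1 + 3 * k) ⊛ (coprime k ⊛ B₃.Q k)))
    ≈⟨ solve𝕊 5 (λ a b c r q →
         a ⊛′ (b ⊛′ (c ⊛′ (r ⊛′ q)))
         ≗′ ((c ⊛′ b) ⊛′ r) ⊛′ (a ⊛′ q))
         (λ _ → refl) (geometric (3 * suc k)) (geometric (2 + 3 * k)) (geometric (1 + 3 * k)) (coprime k) (B₃.Q k) ⟩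
  coprime (suc k) ⊛ B₃.Q (suc k) ∎
  where
  open import Relation.Binary.Reasoning.Setoid 𝕊.setoid
  geometric≡ : ∀ {d e} → d ≡ e → geometric d ≗ geometric e
  geometric≡ d≡e = cong-app (cong geometric d≡e)

J-series≈L-series : ∀ N → J-series N ≈⟦ N ⟧ L-series N
J-series≈L-series N = begin
  J-series N
    ≈⟨ exact (J-series-factors N) ⟩
  coprime N ⊛ R₃.factors N
    ≈⟨ ⊛-cong-trunc (≈-refl {x = coprime N}) theta₃ ⟨
  coprime N ⊛ (B₃.Q N ⊛ theta)
    ≈⟨ exact (⊛-assoc (coprime N) (B₃.Q N) theta) ⟨
  (coprime N ⊛ B₃.Q N) ⊛ theta
    ≈⟨ ⊛-cong-trunc (exact (Q-coprime N)) (≈-refl {x = theta}) ⟨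
  B₁.Q (3 * N) ⊛ theta
    ≈⟨ ⊛-cong-trunc (Stable.Q-stable 1 (ℕ.m≤n*m N 3) ℕ.≤-refl) (≈-refl {x = theta}) ⟩
  B₁.Q N ⊛ theta
    ≈⟨ theta₁ ⟩
  L-series N ∎
  where
  open import Relation.Binary.Reasoning.Setoid (truncated N)
  open Setoid (truncated N) using () renaming (refl to ≈-refl)
  open Theta 1 N using (theta)

  -- `rothe` and stability evaluate the same finite sum; a common factor `B₃.Q N` cancels. `theta₁`
  -- is obtained likewise, with `∑-R₁-term` in place of `rothe`.
  theta₃ : B₃.Q N ⊛ theta ≈⟦ N ⟧ R₃.factors N
  theta₃ = Stable.Q-cancel 3 N (begin
    B₃.Q N ⊛ (B₃.Q N ⊛ theta)
      ≈⟨ Theta.∑-stable 3 N ⟨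
    ∑ (double N) (λ i j → q^ (ε 2 1 i N) ⊛ (B₃.Q i ⊛ B₃.Q j))
      ≈⟨ exact (R₃.rothe N) ⟩
    R₃.factors N ⊛ B₃.Q (double N)
      ≈⟨ exact (⊛-comm (R₃.factors N) (B₃.Q (double N))) ⟩
    B₃.Q (double N) ⊛ R₃.factors N
      ≈⟨ ⊛-cong-trunc (Stable.Q-stable 3 N≤2N ℕ.≤-refl) (≈-refl {x = R₃.factors N}) ⟩
    B₃.Q N ⊛ R₃.factors N ∎)
    where
    N≤2N : N ≤ double N
    N≤2N = ℕ.≤-trans (ℕ.m≤m+n N N) (ℕ.≤-reflexive (sym (double≡n+n N)))

  theta₁ : B₁.Q N ⊛ theta ≈⟦ N ⟧ L-series N
  theta₁ = Stable.Q-cancel 1 N (begin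
    B₁.Q N ⊛ (B₁.Q N ⊛ theta)
      ≈⟨ Theta.∑-stable 1 N ⟨
    ∑ (double N) (λ i j → q^ (ε 2 1 i N) ⊛ (B₁.Q i ⊛ B₁.Q j))
      ≈⟨ exact (∑-R₁-term N) ⟨
    ∑ N (λ l n → B₁.Q l ⊛ L-term n)
      ≈⟨ ∑-cong-trunc N stabilise ⟩
    ∑ N (λ l n → B₁.Q N ⊛ L-term n)
      ≈⟨ exact (*-distribˡ-∑ N (B₁.Q N) (λ _ n → L-term n)) ⟨
    B₁.Q N ⊛ L-series N ∎)
    where
    stabilise : ∀ l n → l + n ≡ N → B₁.Q l ⊛ L-term n ≈⟦ N ⟧ B₁.Q N ⊛ L-term n
    stabilise l n refl = begin
      B₁.Q l ⊛ (q^ (n * n) ⊛ t)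
        ≈⟨ exact (swap (B₁.Q l)) ⟩
      q^ (n * n) ⊛ (B₁.Q l ⊛ t)
        -- `B₁.Q l` is reliable only to degree l; the factor q^(n²) with n² ≥ n raises this to l + n
        -- = N.
        ≈⟨ q^-⊛-trunc (n * n) l+n≤n²+l (⊛-cong-trunc (Stable.Q-stable 1 ℕ.≤-refl (ℕ.m≤m+n l n)) (≈-refl-l {x = t})) ⟩
      q^ (n * n) ⊛ (B₁.Q (l + n) ⊛ t)
        ≈⟨ exact (swap (B₁.Q (l + n))) ⟨
      B₁.Q (l + n) ⊛ (q^ (n * n) ⊛ t) ∎
      where
      open Setoid (truncated l) using () renaming (refl to ≈-refl-l)
      t = R₁.factors n ⊛ B₁.Q (double n)
      swap : ∀ f → f ⊛ (q^ (n * n) ⊛ t) ≗ q^ (n * n) ⊛ (f ⊛ t)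
      swap f = solve𝕊 3 (λ f x t →
        f ⊛′ (x ⊛′ t) ≗′ x ⊛′ (f ⊛′ t))
        (λ _ → refl) f (q^ (n * n)) t
      n≤n² : ∀ n → n ≤ n * n
      n≤n² zero    = z≤n
      n≤n² (suc n) = ℕ.m≤m*n (suc n) (suc n)
      l+n≤n²+l : l + n ≤ n * n + l
      l+n≤n²+l = ℕ.≤-trans (ℕ.≤-reflexive (ℕ.+-comm l n)) (ℕ.+-monoˡ-≤ l (n≤n² n))


-- Raising all intervals by h multiplies the weight of k parts by q^(kh).  Up to this
-- factor U-series k and V-series k count the k-part lists that start as prescribed by
-- U h and V h below, and Y-series k the lists of k + 1 parts starting as in Y o h 1.
U-series Y-series : ℕ → Series
U-series zero    = q^ 0
U-series (suc k) = (q^ 0 ⊕ q^ (suc k)) ⊛ (geometric (suc k) ⊛ Y-series k)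
Y-series k = q^ (1 + 2 * k) ⊛ (geometric (1 + 2 * k) ⊛ U-series k)

V-series : ℕ → Series
V-series zero    = q^ 0
V-series (suc k) = geometric (suc k) ⊛ (Y-series k ⊕ Y-series k)

binomials : ℕ → Series
binomials zero    = q^ 0
binomials (suc k) = (q^ 0 ⊕ q^ (suc k)) ⊛ binomials k

-- From (1 - q^d)(1 + q^d) = 1 - q^(2d). It turns the factors 1 / (1 - q^(k+1)) of `U-series` and
-- `V-series` into the even factors of 1 / (q)_{2k+2}.
geometric-double : ∀ d .{{_ : NonZero d}} → geometric d ≗ (q^ 0 ⊕ q^ d) ⊛ geometric (2 * d)
geometric-double d = 𝕊.trans
  (geo-unique (2 * d) {{ℕ.m*n≢0 2 d}} {F = q^ 0 ⊕ q^ d} twice)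
  (⊛-comm (geometric (2 * d)) (q^ 0 ⊕ q^ d))
  where
  open import Relation.Binary.Reasoning.Setoid 𝕊.setoid
  twice : geometric d ≗ (q^ 0 ⊕ q^ d) ⊕ q^ (2 * d) ⊛ geometric d
  twice = begin
    geometric d
      ≈⟨ geometric-unfold d ⟩
    q^ 0 ⊕ q^ d ⊛ geometric d
      ≈⟨ 𝕊.+-congˡ {q^ 0} (𝕊.*-congˡ {q^ d} (geometric-unfold d)) ⟩
    q^ 0 ⊕ q^ d ⊛ (q^ 0 ⊕ q^ d ⊛ geometric d)
      ≈⟨ solve𝕊 2 (λ x g → con𝕊 1 ⊕′ x ⊛′ (con𝕊 1 ⊕′ x ⊛′ g) ≗′ (con𝕊 1 ⊕′ x) ⊕′ (x ⊛′ x) ⊛′ g)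
           (λ _ → refl) (q^ d) (geometric d) ⟩
    (q^ 0 ⊕ q^ d) ⊕ (q^ d ⊛ q^ d) ⊛ geometric d
      ≈⟨ 𝕊.+-congˡ {q^ 0 ⊕ q^ d} (𝕊.*-congʳ {geometric d} (λ n →
           trans (sym (q^-+ d d n)) (cong (λ e → q^ e n) (cong (d +_) (sym (ℕ.+-identityʳ d)))))) ⟩
    (q^ 0 ⊕ q^ d) ⊕ q^ (2 * d) ⊛ geometric d ∎

Q-double-suc : ∀ k → B₁.Q (double (suc k)) ≗
  geometric (2 * suc k) ⊛ (geometric (1 + 2 * k) ⊛ B₁.Q (double k))
Q-double-suc k n = cong (λ f → f n) (cong₂ (λ d e → geometric d ⊛ (geometric e ⊛ B₁.Q (double k)))
  (trans (ℕ.*-identityˡ _) (trans (cong (suc ∘ suc) (double≡2* k)) (sym (ℕ.*-suc 2 k))))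
  (trans (ℕ.*-identityˡ _) (cong suc (double≡2* k))))
  where
  double≡2* : ∀ k → double k ≡ 2 * k
  double≡2* k = trans (double≡n+n k) (cong (k +_) (sym (ℕ.+-identityʳ k)))

q^-square-suc : ∀ k → q^ (suc k * suc k) ≗ q^ (1 + 2 * k) ⊛ q^ (k * k)
q^-square-suc k n = trans
  (cong (λ e → q^ e n) (solve 1 (λ k → (con 1 :+ k) :* (con 1 :+ k) := (con 1 :+ con 2 :* k) :+ k :* k) refl k))
  (q^-+ (1 + 2 * k) (k * k) n)

-- Here `binomials k` is (-q)ₖ, and (-1)_{k+1} = 2 (-q)ₖ, the 2 being written as a sum of two equal
-- series.
factors-suc : ∀ k → R₁.factors (suc k) ≗
  (q^ 0 ⊕ q^ (suc k)) ⊛ ((binomials k ⊛ binomials k) ⊕ (binomials k ⊛ binomials k))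
factors-suc zero = solve𝕊 1 (λ x →
  (con𝕊 1 ⊕′ x) ⊛′ ((con𝕊 1 ⊕′ con𝕊 1) ⊛′ con𝕊 1) ≗′
  (con𝕊 1 ⊕′ x) ⊛′ (con𝕊 1 ⊛′ con𝕊 1 ⊕′ con𝕊 1 ⊛′ con𝕊 1)) (λ _ → refl) (q^ 1)
factors-suc (suc k) = begin
  (q^ 0 ⊕ q^ (1 + 1 * suc k)) ⊛ ((q^ 0 ⊕ q^ (1 * suc k)) ⊛ R₁.factors (suc k))
    ≈⟨ 𝕊.*-cong (𝕊.+-congˡ {q^ 0} (q^≡ (cong suc (ℕ.*-identityˡ (suc k)))))
         (𝕊.*-cong (𝕊.+-congˡ {q^ 0} (q^≡ (ℕ.*-identityˡ (suc k)))) (factors-suc k)) ⟩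
  (q^ 0 ⊕ q^ (suc (suc k))) ⊛ (b ⊛ (b ⊛ (d ⊛ d ⊕ d ⊛ d)))
    ≈⟨ solve𝕊 3 (λ x b d → x ⊛′ (b ⊛′ (b ⊛′ (d ⊛′ d ⊕′ d ⊛′ d)))
                          ≗′ x ⊛′ ((b ⊛′ d) ⊛′ (b ⊛′ d) ⊕′ (b ⊛′ d) ⊛′ (b ⊛′ d)))
         (λ _ → refl) (q^ 0 ⊕ q^ (suc (suc k))) b d ⟩
  (q^ 0 ⊕ q^ (suc (suc k))) ⊛ ((b ⊛ d) ⊛ (b ⊛ d) ⊕ (b ⊛ d) ⊛ (b ⊛ d)) ∎
  where
  open import Relation.Binary.Reasoning.Setoid 𝕊.setoid
  b = q^ 0 ⊕ q^ (suc k)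
  d = binomials k
  q^≡ : ∀ {d e} → d ≡ e → q^ d ≗ q^ e
  q^≡ d≡e = cong-app (cong q^ d≡e)

U-series-closed : ∀ k → U-series k ≗ q^ (k * k) ⊛ ((binomials k ⊛ binomials k) ⊛ B₁.Q (double k))
U-series-closed zero = solve𝕊 0 (con𝕊 1 ≗′ con𝕊 1 ⊛′ ((con𝕊 1 ⊛′ con𝕊 1) ⊛′ con𝕊 1)) (λ _ → refl)
U-series-closed (suc k) = begin
  b ⊛ (geometric (suc k) ⊛ (x ⊛ (g ⊛ U-series k)))
    ≈⟨ 𝕊.*-congˡ {b} (𝕊.*-cong (geometric-double (suc k))
         (𝕊.*-congˡ {x} (𝕊.*-congˡ {g} (U-series-closed k)))) ⟩
  b ⊛ ((b ⊛ g₂) ⊛ (x ⊛ (g ⊛ (q^ (k * k) ⊛ ((d ⊛ d) ⊛ B₁.Q (double k))))))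
    ≈⟨ solve𝕊 7 (λ b g₂ x g y d q →
         b ⊛′ ((b ⊛′ g₂) ⊛′ (x ⊛′ (g ⊛′ (y ⊛′ ((d ⊛′ d) ⊛′ q)))))
         ≗′ (x ⊛′ y) ⊛′ (((b ⊛′ d) ⊛′ (b ⊛′ d)) ⊛′ (g₂ ⊛′ (g ⊛′ q))))
         (λ _ → refl) b g₂ x g (q^ (k * k)) d (B₁.Q (double k)) ⟩
  (x ⊛ q^ (k * k)) ⊛ (((b ⊛ d) ⊛ (b ⊛ d)) ⊛ (g₂ ⊛ (g ⊛ B₁.Q (double k))))
    ≈⟨ 𝕊.*-cong (q^-square-suc k) (𝕊.*-congˡ {(b ⊛ d) ⊛ (b ⊛ d)} (Q-double-suc k)) ⟨
  q^ (suc k * suc k) ⊛ (((b ⊛ d) ⊛ (b ⊛ d)) ⊛ B₁.Q (double (suc k))) ∎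
  where
  open import Relation.Binary.Reasoning.Setoid 𝕊.setoid
  b = q^ 0 ⊕ q^ (suc k)
  x = q^ (1 + 2 * k)
  g = geometric (1 + 2 * k)
  g₂ = geometric (2 * suc k)
  d = binomials k

V-series≗L-term : ∀ k → V-series k ≗ L-term k
V-series≗L-term zero = solve𝕊 0 (con𝕊 1 ≗′ con𝕊 1 ⊛′ (con𝕊 1 ⊛′ con𝕊 1)) (λ _ → refl)
V-series≗L-term (suc k) = begin
  geometric (suc k) ⊛ (x ⊛ (g ⊛ U-series k) ⊕ x ⊛ (g ⊛ U-series k))
    ≈⟨ 𝕊.*-cong (geometric-double (suc k)) (𝕊.+-cong Y Y) ⟩
  (b ⊛ g₂) ⊛ (y ⊕ y)
    ≈⟨ solve𝕊 7 (λ b g₂ x g z d q →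
         (b ⊛′ g₂) ⊛′ (x ⊛′ (g ⊛′ (z ⊛′ (d ⊛′ q))) ⊕′ x ⊛′ (g ⊛′ (z ⊛′ (d ⊛′ q))))
         ≗′ (x ⊛′ z) ⊛′ ((b ⊛′ (d ⊕′ d)) ⊛′ (g₂ ⊛′ (g ⊛′ q))))
         (λ _ → refl) b g₂ x g (q^ (k * k)) (binomials k ⊛ binomials k) (B₁.Q (double k)) ⟩
  (x ⊛ q^ (k * k)) ⊛ ((b ⊛ (binomials k ⊛ binomials k ⊕ binomials k ⊛ binomials k))
    ⊛ (g₂ ⊛ (g ⊛ B₁.Q (double k))))
    ≈⟨ 𝕊.*-cong (q^-square-suc k) (𝕊.*-cong (factors-suc k) (Q-double-suc k)) ⟨
  L-term (suc k) ∎
  where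
  open import Relation.Binary.Reasoning.Setoid 𝕊.setoid
  b = q^ 0 ⊕ q^ (suc k)
  x = q^ (1 + 2 * k)
  g = geometric (1 + 2 * k)
  g₂ = geometric (2 * suc k)
  y = x ⊛ (g ⊛ (q^ (k * k) ⊛ ((binomials k ⊛ binomials k) ⊛ B₁.Q (double k))))
  Y : x ⊛ (g ⊛ U-series k) ≗ y
  Y = 𝕊.*-congˡ {x} (𝕊.*-congˡ {g} (U-series-closed k))

-- Counting

open Finite
open Equivalence using (to; from)
open ℤSolver using (_:-_) renaming (solve to solveℤ; _:+_ to _:+ℤ_; _:=_ to _:=ℤ_)

private variable
  A B : Set
  P P′ : A → Set
  m n : ℕ

HasCard : (A → Set) → ℕ → Set
HasCard P n = ∃ λ (F : Finite P) → card F ≡ n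

-- Two duplicate-free enumerations of one predicate are permutations of each other, so J and L may
-- be computed from any enumeration.
card-unique : (F : Finite P) → HasCard P n → card F ≡ n
card-unique F (G , card≡n) = trans (↭-length (∼bag⇒↭ (unique∧set⇒bag (unique F) (unique G)
  (λ {x} → mk⇔ (from (complete G x) ∘ to (complete F x)) (from (complete F x) ∘ to (complete G x))))))
  card≡n

HasCard-resp : (∀ x → P x ⇔ P′ x) → HasCard P n → HasCard P′ n
HasCard-resp P⇔P′ (F , card≡n) = record
  { elements = elements F
  ; unique   = unique F
  ; complete = λ x → mk⇔ (to (P⇔P′ x) ∘ to (complete F x)) (from (complete F x) ∘ from (P⇔P′ x))
  } , card≡n

HasCard-∅ : (∀ x → ¬ P x) → HasCard P 0
HasCard-∅ ¬P = record
  { elements = [] ; unique = [] ; complete = λ x → mk⇔ (λ ()) (λ p → contradiction p (¬P x)) } , refl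

HasCard-≡ : (a : A) → HasCard (_≡ a) 1
HasCard-≡ a = record
  { elements = a ∷ [] ; unique = [] ∷ [] ; complete = λ x → mk⇔ (λ { (here x≡a) → x≡a ; (there ()) }) here } , refl

HasCard-⊎ : HasCard P m → HasCard P′ n → (∀ {x} → P x → ¬ P′ x) → HasCard (λ x → P x ⊎ P′ x) (m + n)
HasCard-⊎ (F , refl) (G , refl) disjoint = record
  { elements = elements F ++ elements G
  ; unique   = Unique.++⁺ (unique F) (unique G)
                 (λ (x∈F , x∈G) → disjoint (to (complete F _) x∈F) (to (complete G _) x∈G))
  ; complete = λ x → mk⇔
      (Sum.map (to (complete F x)) (to (complete G x)) ∘ ∈-++⁻ (elements F))
      Sum.[ ∈-++⁺ˡ ∘ from (complete F x) , ∈-++⁺ʳ (elements F) ∘ from (complete G x) ]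
  } , length-++ (elements F)

HasCard-map : (f : A → B) → (∀ {x y} → f x ≡ f y → x ≡ y) →
              HasCard P n → HasCard (λ y → ∃ λ x → P x × y ≡ f x) n
HasCard-map f injective (F , refl) = record
  { elements = map f (elements F)
  ; unique   = Unique.map⁺ injective (unique F)
  ; complete = λ y → mk⇔
      (λ y∈ → let x , x∈F , y≡fx = ∈-map⁻ f y∈ in x , to (complete F x) x∈F , y≡fx)
      (λ { (x , Px , refl) → ∈-map⁺ f (from (complete F x) Px) })
  } , length-map f (elements F)

Counted : (T : A → Set) (weight : A → ℕ) (f : Series) → ℕ → Set
Counted T weight f n = HasCard (λ x → T x × weight x ≡ n) (f n)

Counted-cong : ∀ {T : A → Set} {w f g} → f ≗ g → Counted T w f n → Counted T w g n
Counted-cong {n = n} f≗g = subst (HasCard _) (f≗g n)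

Counted-shift : ∀ {T : A → Set} {w : A → ℕ} {f} d → (∀ k → d + k ≡ n → Counted T w f k) →
                Counted T (λ x → d + w x) (q^ d ⊛ f) n
Counted-shift {n = n} {T = T} {w} {f} d counted with d ≤? n
... | yes d≤n = subst₂ (λ n c → HasCard (λ x → T x × d + w x ≡ n) c) d+k≡n
    (trans (sym (q^-⊛-+ d f (n ∸ d))) (cong (q^ d ⊛ f) d+k≡n))
    (HasCard-resp (λ x → mk⇔ (λ (Tx , eq) → Tx , cong (d +_) eq)
                             (λ (Tx , eq) → Tx , ℕ.+-cancelˡ-≡ d _ _ eq))
      (counted (n ∸ d) d+k≡n))
  where d+k≡n = ℕ.m+[n∸m]≡n d≤n
... | no d≰n = subst (HasCard _) (sym (q^-⊛-< f (ℕ.≰⇒> d≰n)))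
  (HasCard-∅ (λ { x (_ , refl) → d≰n (ℕ.m≤m+n d _) }))

HasCard-0 : ∀ {d} f → n < d → (∀ x → ¬ P x) → HasCard P ((q^ d ⊛ f) n)
HasCard-0 f n<d ¬P = subst (HasCard _) (sym (q^-⊛-< f n<d)) (HasCard-∅ ¬P)

module Chains (R : A → A → Set) (weight : A → ℕ) where

  -- The condition on the head acts as a state: the recurrences below change only what may come
  -- first.
  Chain : (A → Set) → List A → Set
  Chain H []       = ⊤
  Chain H (x ∷ xs) = H x × Chain (R x) xs

  total : List A → ℕ
  total = sum ∘ map weight

  module _ {H H₁ H₂ : A → Set} (H⇔ : ∀ {x} → H x ⇔ (H₁ x ⊎ H₂ x)) (disjoint : ∀ {x} → H₁ x → ¬ H₂ x) where

    -- The empty list is a chain for both conditions and would be counted twice, so E has to exclude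
    -- it. In `HasCard-cons` it is counted once, with H′.
    HasCard-split : ∀ {E : List A → Set} → ¬ E [] →
      HasCard (λ xs → Chain H₁ xs × E xs) m → HasCard (λ xs → Chain H₂ xs × E xs) n →
      HasCard (λ xs → Chain H xs × E xs) (m + n)
    HasCard-split ¬E[] c₁ c₂ = HasCard-resp
      (λ { []       → mk⇔ (Sum.[ (λ p → p) , (λ p → p) ]) inj₁
         ; (x ∷ xs) → mk⇔
             Sum.[ (λ ((h , c) , e) → (from H⇔ (inj₁ h) , c) , e) , (λ ((h , c) , e) → (from H⇔ (inj₂ h) , c) , e) ]
             (λ ((h , c) , e) → Sum.map (λ h → (h , c) , e) (λ h → (h , c) , e) (to H⇔ h)) })
      (HasCard-⊎ c₁ c₂ (λ { {[]} (_ , e) _ → ¬E[] e ; {x ∷ _} ((h₁ , _) , _) ((h₂ , _) , _) → disjoint h₁ h₂ }))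

  HasCard-cons : ∀ {H H′ : A → Set} a → (∀ {x} → H x ⇔ (H′ x ⊎ x ≡ a)) → ¬ H′ a → ∀ {E : List A → Set} →
    HasCard (λ xs → Chain H′ xs × E xs) m → HasCard (λ xs → Chain (R a) xs × E (a ∷ xs)) n →
    HasCard (λ xs → Chain H xs × E xs) (m + n)
  HasCard-cons {H = H} {H′} a H⇔ ¬H′a {E} c′ cₐ = HasCard-resp equiv
    (HasCard-⊎ c′ (HasCard-map (a ∷_) ∷-injectiveʳ cₐ)
      (λ { ((h , _) , _) (_ , _ , refl) → ¬H′a h }))
    where
    forth : ∀ xs → (Chain H′ xs × E xs) ⊎ (∃ λ ys → (Chain (R a) ys × E (a ∷ ys)) × xs ≡ a ∷ ys) →
            Chain H xs × E xs
    forth []       (inj₁ p)                     = p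
    forth (x ∷ xs) (inj₁ ((h , c) , e))         = (from H⇔ (inj₁ h) , c) , e
    forth (x ∷ xs) (inj₂ (_ , (c , e) , refl)) = (from H⇔ (inj₂ refl) , c) , e
    back : ∀ xs → Chain H xs × E xs →
           (Chain H′ xs × E xs) ⊎ (∃ λ ys → (Chain (R a) ys × E (a ∷ ys)) × xs ≡ a ∷ ys)
    back []       p             = inj₁ p
    back (x ∷ xs) ((h , c) , e) with to H⇔ h
    ... | inj₁ h′   = inj₁ ((h′ , c) , e)
    ... | inj₂ refl = inj₂ (xs , (c , e) , refl)
    equiv = λ xs → mk⇔ (forth xs) (back xs)

  Chain-map : ∀ {H H′ : A → Set} → (∀ {x} → H x → H′ x) → ∀ {xs} → Chain H xs → Chain H′ xs
  Chain-map f {[]}    c       = c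
  Chain-map f {_ ∷ _} (h , c) = f h , c

-- Overpartitions with no part divisible by 3

module OrdinaryCount where

  open Overpartitions ordinary using (_⊴_; IsOverpartition)

  Admissible : Occurrence ℕ → Set
  Admissible x = 1 ≤ part x × ¬ 3 ∣ part x

  -- In `⊴` only the overline of the later part matters, so `(s , false)` represents either
  -- occurrence of s.
  From After : ℕ → Occurrence ℕ → Set
  From  s y = s ≤ part y × Admissible y
  After s y = (s , false) ⊴ y × Admissible y

  open Chains (After ∘ part) part

  CountedFrom CountedAfter : ℕ → ℕ → Series → Set
  CountedFrom  N s f = ∀ {n} → n ≤ N → Counted (Chain (From  s)) total f n
  CountedAfter N s f = ∀ {n} → n ≤ N → Counted (Chain (After s)) total f n

  module _ {s} (1≤s : 1 ≤ s) (3∤s : ¬ 3 ∣ s) where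

    private instance
      s≢0 : NonZero s
      s≢0 = >-nonZero 1≤s

    After⇔ : ∀ {y} → After s y ⇔ (From (suc s) y ⊎ y ≡ (s , false))
    After⇔ = mk⇔
      (λ { (inj₁ s<t , a) → inj₁ (s<t , a)
         ; (inj₂ (refl , ¬o) , a) → inj₂ (not-overlined ¬o) })
      (λ { (inj₁ (s<t , a)) → inj₁ s<t , a
         ; (inj₂ refl) → inj₂ (refl , λ ()) , 1≤s , 3∤s })
      where
      not-overlined : ∀ {o} → ¬ o ≡ true → (s , o) ≡ (s , false)
      not-overlined {false} _  = refl
      not-overlined {true}  ¬o = contradiction refl ¬o

    From⇔ : ∀ {y} → From s y ⇔ (After s y ⊎ y ≡ (s , true))
    From⇔ = mk⇔ forth
      (λ { (inj₁ (inj₁ s<t , a)) → ℕ.<⇒≤ s<t , a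
         ; (inj₁ (inj₂ (refl , _) , a)) → ℕ.≤-refl , a
         ; (inj₂ refl) → ℕ.≤-refl , 1≤s , 3∤s })
      where
      forth : ∀ {y} → From s y → After s y ⊎ y ≡ (s , true)
      forth (s≤t , a) with ℕ.m≤n⇒m<n∨m≡n s≤t
      ... | inj₁ s<t = inj₁ (inj₁ s<t , a)
      forth {_ , false} (s≤t , a) | inj₂ refl = inj₁ (inj₂ (refl , λ ()) , a)
      forth {_ , true}  (s≤t , a) | inj₂ refl = inj₂ refl

    -- A list either has only parts above s or begins with a plain s, whose removal leaves a list of
    -- the same kind: G = f + q^s G. Since s ≥ 1, the removal lowers the total.
    count-After : ∀ {N f} → CountedFrom N (suc s) f → CountedAfter N s (geometric s ⊛ f)
    count-After {N} {f} c {n} = <-rec (λ n → n ≤ N → Counted (Chain (After s)) total (geometric s ⊛ f) n)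
      (λ n rec n≤N → Counted-cong (λ n → sym (geometric-⊛ s f n))
        (HasCard-cons (s , false) After⇔ (λ (s<s , _) → ℕ.<-irrefl refl s<s) (c n≤N)
          (Counted-shift s (λ k s+k≡n → rec (k<n s+k≡n) (ℕ.≤-trans (ℕ.<⇒≤ (k<n s+k≡n)) n≤N))))) n
      where
      k<n : ∀ {k n} → s + k ≡ n → k < n
      k<n {k} refl = ℕ.+-monoˡ-≤ k 1≤s

    count-From : ∀ {N f} → CountedFrom N (suc s) f → CountedFrom N s (overlinedGeometric s ⊛ f)
    count-From {N} {f} c {n} n≤N = Counted-cong regroup
      (HasCard-cons (s , true) From⇔ (λ { (inj₁ s<s , _) → ℕ.<-irrefl refl s<s ; (inj₂ (_ , ¬o) , _) → ¬o refl })
        (count-After c n≤N)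
        (Counted-shift s (λ k s+k≡n → count-After c
          (ℕ.≤-trans (ℕ.≤-trans (ℕ.m≤n+m k s) (ℕ.≤-reflexive s+k≡n)) n≤N))))
      where
      regroup : geometric s ⊛ f ⊕ q^ s ⊛ (geometric s ⊛ f) ≗ overlinedGeometric s ⊛ f
      regroup = solve𝕊 3 (λ g x f →
        g ⊛′ f ⊕′ x ⊛′ (g ⊛′ f)
        ≗′ ((con𝕊 1 ⊕′ x) ⊛′ g) ⊛′ f)
        (λ _ → refl) (geometric s) (q^ s) f

  skip-multiple : ∀ {N s f} → 3 ∣ s → CountedFrom N (suc s) f → CountedFrom N s f
  skip-multiple {s = s} 3∣s c n≤N = HasCard-resp
    (λ xs → mk⇔ (λ (ch , eq) → Chain-map {From (suc s)} {From s} (λ (s<t , a) → ℕ.<⇒≤ s<t , a) ch , eq)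
                (λ (ch , eq) → Chain-map {From s} {From (suc s)} (λ {y} → bump {y}) ch , eq)) (c n≤N)
    where
    bump : ∀ {y} → From s y → From (suc s) y
    bump (s≤t , a) = ℕ.≤∧≢⇒< s≤t (λ { refl → proj₂ a 3∣s }) , a

  -- A part above N cannot occur in a total n ≤ N. This ends the infinite product and is why
  -- `CountedFrom` carries the bound N.
  count-beyond : ∀ {N s} → N < s → CountedFrom N s (q^ 0)
  count-beyond {s = s} N<s {zero} n≤N = HasCard-resp
    (λ { [] → mk⇔ (λ _ → tt , refl) (λ _ → refl)
       ; (x ∷ xs) → mk⇔ (λ ()) (λ (((_ , 1≤x , _) , _) , eq) →
           contradiction (ℕ.m+n≡0⇒m≡0 (part x) eq) (ℕ.>⇒≢ 1≤x)) }) (HasCard-≡ [])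
  count-beyond {s = s} N<s {suc n} n<N = HasCard-∅
    (λ { (x ∷ xs) (((s≤x , _) , _) , eq) → ℕ.<⇒≱ N<s (ℕ.≤-trans s≤x
           (ℕ.≤-trans (ℕ.m≤m+n (part x) (total xs)) (ℕ.≤-trans (ℕ.≤-reflexive eq) n<N))) })

  count-block : ∀ {N f} k → CountedFrom N (1 + 3 * suc k) f →
    CountedFrom N (1 + 3 * k) (overlinedGeometric (1 + 3 * k) ⊛ (overlinedGeometric (2 + 3 * k) ⊛ f))
  count-block {N} {f} k c =
    count-From (s≤s z≤n) (3∤ 1 (>⇒∤ (s≤s (s≤s z≤n))))
      (count-From (s≤s z≤n) (3∤ 2 (>⇒∤ (s≤s (s≤s (s≤s z≤n)))))
        (skip-multiple {f = f} 3∣3+3k (subst (λ s → CountedFrom N s f) (cong suc (ℕ.*-suc 3 k)) c)))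
    where
    3∣3+3k : 3 ∣ 3 + 3 * k
    3∣3+3k = ∣m∣n⇒∣m+n ∣-refl (m∣m*n k)
    3∤ : ∀ r → ¬ 3 ∣ r → ¬ 3 ∣ r + 3 * k
    3∤ r 3∤r 3∣ = 3∤r (∣m+n∣m⇒∣n (subst (3 ∣_) (ℕ.+-comm r (3 * k)) 3∣) (m∣m*n k))

  count-blocks : ∀ {N f} k → CountedFrom N (1 + 3 * k) f → CountedFrom N 1 (J-series k ⊛ f)
  count-blocks {f = f} zero    c n≤N = Counted-cong (λ n → sym (⊛-identityˡ f n)) (c n≤N)
  count-blocks {f = f} (suc k) c n≤N =
    Counted-cong (solve𝕊 4 (λ j a b f →
        j ⊛′ (a ⊛′ (b ⊛′ f)) ≗′ (j ⊛′ (a ⊛′ b)) ⊛′ f)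
        (λ _ → refl) (J-series k) (overlinedGeometric (1 + 3 * k)) (overlinedGeometric (2 + 3 * k)) f)
      (count-blocks k (count-block k c) n≤N)

  count-J : ∀ N → HasCard (λ xs → Chain (From 1) xs × total xs ≡ N) (J-series N N)
  count-J N = Counted-cong (λ n → trans (⊛-comm (J-series N) (q^ 0) n) (⊛-identityˡ (J-series N) n))
    (count-blocks N (count-beyond (s≤s (ℕ.m≤n*m N 3))) ℕ.≤-refl)

  After-chain : ∀ x xs → All (λ y → 1 ≤ part y) xs → Linked _⊴_ (x ∷ xs) → NoPartDivisibleBy3 xs →
                Chain (After (part x)) xs
  After-chain x []       _        _            _         = tt
  After-chain x (y ∷ ys) (p ∷ ps) (x⊴y ∷ link) (3∤ ∷ 3∤s) = (x⊴y , p , 3∤) , After-chain y ys ps link 3∤s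

  After-chain⁻ : ∀ x xs → Chain (After (part x)) xs →
                 All (λ y → 1 ≤ part y) xs × Linked _⊴_ (x ∷ xs) × NoPartDivisibleBy3 xs
  After-chain⁻ x []       _                      = [] , [-] , []
  After-chain⁻ x (y ∷ ys) ((x⊴y , p , 3∤) , ch) with After-chain⁻ y ys ch
  ... | ps , link , 3∤s = p ∷ ps , x⊴y ∷ link , 3∤ ∷ 3∤s

  overpartition⇔ : ∀ n xs → (Chain (From 1) xs × total xs ≡ n) ⇔ (IsOverpartition n xs × NoPartDivisibleBy3 xs)
  overpartition⇔ n []       = mk⇔ (λ (_ , eq) → ([] , [] , eq) , []) (λ ((_ , _ , eq) , _) → tt , eq)
  overpartition⇔ n (x ∷ xs) = mk⇔
    (λ { (((_ , p , 3∤) , ch) , eq) → let ps , link , 3∤s = After-chain⁻ x xs ch in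
         (p ∷ ps , link , eq) , 3∤ ∷ 3∤s })
    (λ { ((p ∷ ps , link , eq) , 3∤ ∷ 3∤s) → ((p , p , 3∤) , After-chain x xs ps link 3∤s) , eq })

  J≡ : ∀ n → J n ≡ J-series n n
  J≡ n = card-unique (Overpartitions.finite ordinary (all? (λ x → ¬? (3 ∣? part x))) n)
    (HasCard-resp (overpartition⇔ n) (count-J n))

-- Overpartitions with n copies of n as chains of intervals

module CopiesCount where

  open Overpartitions nCopiesOfN using (_⊴_; IsOverpartition)

  Occ : Set
  Occ = Occurrence (ℕ × ℕ)

  upper : Occ → ℕ
  upper ((n , j) , _) = n + j

  -- In terms of the intervals [n − j , n + j], U h admits those that may follow an
  -- interval ending at h, V h those starting at or after h, and Y o h t those of length
  -- at least 2t starting at h.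
  U : ℕ → Occ → Set
  U h ((n , j) , o) = 1 ≤ j × (h + j < n ⊎ (h + j ≡ n × ¬ o ≡ true))

  V : ℕ → Occ → Set
  V h ((n , j) , o) = 1 ≤ j × h + j ≤ n

  Y : Bool → ℕ → ℕ → Occ → Set
  Y o′ h t ((n , j) , o) = t ≤ j × h + j ≡ n × o ≡ o′

  open Chains (U ∘ upper) (proj₁ ∘ part)

  CountedLength : (Occ → Set) → ℕ → Series → ℕ → Set
  CountedLength H k f n = HasCard (λ xs → Chain H xs × length xs ≡ k × total xs ≡ n) (f n)

  -- Splitting off an overlined interval that starts at h leads from V h to U h; splitting off a
  -- plain one leads in `U⇔` from U h to V (h + 1). Alternating the two raises h.
  V⇔ : ∀ {h y} → V h y ⇔ (U h y ⊎ Y true h 1 y)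
  V⇔ {h} = mk⇔ forth
    (λ { (inj₁ (p , inj₁ lt)) → p , ℕ.<⇒≤ lt
       ; (inj₁ (p , inj₂ (eq , _))) → p , ℕ.≤-reflexive eq
       ; (inj₂ (p , eq , _)) → p , ℕ.≤-reflexive eq })
    where
    forth : ∀ {y} → V h y → U h y ⊎ Y true h 1 y
    forth (p , le) with ℕ.m≤n⇒m<n∨m≡n le
    ... | inj₁ lt = inj₁ (p , inj₁ lt)
    forth {_ , false} (p , le) | inj₂ eq = inj₁ (p , inj₂ (eq , λ ()))
    forth {_ , true}  (p , le) | inj₂ eq = inj₂ (p , eq , refl)

  U⇔ : ∀ {h y} → U h y ⇔ (V (suc h) y ⊎ Y false h 1 y)
  U⇔ {h} = mk⇔ forth
    (λ { (inj₁ (p , lt)) → p , inj₁ lt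
       ; (inj₂ (p , eq , refl)) → p , inj₂ (eq , λ ()) })
    where
    forth : ∀ {y} → U h y → V (suc h) y ⊎ Y false h 1 y
    forth (p , inj₁ lt) = inj₁ (p , lt)
    forth {_ , false} (p , inj₂ (eq , ¬o)) = inj₂ (p , eq , refl)
    forth {_ , true}  (p , inj₂ (eq , ¬o)) = contradiction refl ¬o

  Y⇔ : ∀ {o h t y} → Y o h t y ⇔ (Y o h (suc t) y ⊎ y ≡ ((h + t , t) , o))
  Y⇔ {o} {h} {t} = mk⇔ forth
    (λ { (inj₁ (lt , p)) → ℕ.<⇒≤ lt , p
       ; (inj₂ refl) → ℕ.≤-refl , refl , refl })
    where
    forth : ∀ {y} → Y o h t y → Y o h (suc t) y ⊎ y ≡ ((h + t , t) , o)
    forth (le , eq , eqₒ) with ℕ.m≤n⇒m<n∨m≡n le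
    ... | inj₁ lt = inj₁ (lt , eq , eqₒ)
    forth (le , refl , refl) | inj₂ refl = inj₂ refl

  U-Y-disjoint : ∀ {h y} → U h y → ¬ Y true h 1 y
  U-Y-disjoint (_ , inj₁ lt)       (_ , eq , _) = ℕ.<⇒≢ lt eq
  U-Y-disjoint (_ , inj₂ (_ , ¬o)) (_ , _ , o)  = ¬o o

  V-Y-disjoint : ∀ {h y} → V (suc h) y → ¬ Y false h 1 y
  V-Y-disjoint (_ , lt) (_ , eq , _) = ℕ.<⇒≢ lt eq

  too-heavy : ∀ {H : Occ → Set} {k n} → (∀ {y} → H y → n < proj₁ (part y)) →
              ∀ xs → ¬ (Chain H xs × length xs ≡ suc k × total xs ≡ n)
  too-heavy heavy (x ∷ xs) ((h , _) , _ , refl) = ℕ.<⇒≱ (heavy h) (ℕ.m≤m+n _ (total xs))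

  count-empty : ∀ H n → CountedLength H 0 (q^ 0) n
  count-empty H zero    = HasCard-resp
    (λ { [] → mk⇔ (λ _ → tt , refl , refl) (λ _ → refl) ; (x ∷ xs) → mk⇔ (λ ()) (λ ()) }) (HasCard-≡ [])
  count-empty H (suc n) = HasCard-∅ (λ { [] () ; (_ ∷ _) () })

  module _ (k : ℕ) (count-U : ∀ h n → CountedLength (U h) k (q^ (k * h) ⊛ U-series k) n) where

    private
      K = suc k
      w = 1 + 2 * k
      u = U-series k
      g = geometric w
      G = geometric K
      y = Y-series k

    count-Y : ∀ o h t n → 1 ≤ t → CountedLength (Y o h t) K (q^ (K * h + t * w) ⊛ (g ⊛ u)) n
    count-Y o h t n 1≤t = go n t 1≤t (ℕ.m<n+m n 1≤t)
      where
      -- The bound d drops while t rises; once t > n, there are no lists and the coefficient is 0.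
      go : ∀ d t → 1 ≤ t → n < t + d → CountedLength (Y o h t) K (q^ (K * h + t * w) ⊛ (g ⊛ u)) n
      go zero t 1≤t n<t = HasCard-0 (g ⊛ u)
        (ℕ.<-≤-trans n<t′ (ℕ.≤-trans (ℕ.m≤m*n t w) (ℕ.m≤n+m (t * w) (K * h))))
        (too-heavy (λ (t≤j , eq , _) → ℕ.<-≤-trans n<t′ (ℕ.≤-trans t≤j (ℕ.≤-trans (ℕ.m≤n+m _ h) (ℕ.≤-reflexive eq)))))
        where n<t′ = subst (n <_) (ℕ.+-identityʳ t) n<t
      go (suc d) t 1≤t n<t+d = subst (HasCard _) (regroup n)
        (HasCard-cons a Y⇔ (λ (t<t , _) → ℕ.<-irrefl refl t<t)
          (go d (suc t) (s≤s z≤n) (subst (n <_) (ℕ.+-suc t d) n<t+d))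
          (HasCard-resp (λ xs → mk⇔ (λ ((c , l) , e) → c , cong suc l , e)
                                    (λ (c , l , e) → (c , ℕ.suc-injective l) , e))
            (Counted-shift (h + t) (λ m _ → HasCard-resp
              (λ xs → mk⇔ (λ (c , l , e) → (c , l) , e) (λ ((c , l) , e) → c , l , e))
              (count-U (h + t + t) m)))))
        where
        a : Occ
        a = (h + t , t) , o
        regroup : q^ (K * h + suc t * w) ⊛ (g ⊛ u) ⊕ q^ (h + t) ⊛ (q^ (k * (h + t + t)) ⊛ u)
                    ≗ q^ (K * h + t * w) ⊛ (g ⊛ u)
        regroup = begin
          q^ (K * h + suc t * w) ⊛ (g ⊛ u) ⊕ q^ (h + t) ⊛ (q^ (k * (h + t + t)) ⊛ u)
            ≈⟨ 𝕊.+-cong (𝕊.*-congʳ {g ⊛ u} shift₁) (𝕊.sym (⊛-assoc (q^ (h + t)) (q^ (k * (h + t + t))) u)) ⟩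
          (q^ (K * h + t * w) ⊛ q^ w) ⊛ (g ⊛ u) ⊕ (q^ (h + t) ⊛ q^ (k * (h + t + t))) ⊛ u
            ≈⟨ 𝕊.+-congˡ {(q^ (K * h + t * w) ⊛ q^ w) ⊛ (g ⊛ u)} (𝕊.*-congʳ {u} shift₂) ⟩
          (q^ (K * h + t * w) ⊛ q^ w) ⊛ (g ⊛ u) ⊕ q^ (K * h + t * w) ⊛ u
            ≈⟨ solve𝕊 4 (λ e x v u → (e ⊛′ x) ⊛′ v ⊕′ e ⊛′ u ≗′ e ⊛′ (u ⊕′ x ⊛′ v)) (λ _ → refl)
                 (q^ (K * h + t * w)) (q^ w) (g ⊛ u) u ⟩
          q^ (K * h + t * w) ⊛ (u ⊕ q^ w ⊛ (g ⊛ u))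
            ≈⟨ 𝕊.*-congˡ {q^ (K * h + t * w)} (geometric-⊛ w u) ⟨
          q^ (K * h + t * w) ⊛ (g ⊛ u) ∎
          where
          open import Relation.Binary.Reasoning.Setoid 𝕊.setoid
          shift₁ : q^ (K * h + suc t * w) ≗ q^ (K * h + t * w) ⊛ q^ w
          shift₁ n = trans (cong (λ e → q^ e n)
            (solve 3 (λ a t w → a :+ (con 1 :+ t) :* w := (a :+ t :* w) :+ w) refl (K * h) t w))
            (q^-+ (K * h + t * w) w n)
          shift₂ : q^ (h + t) ⊛ q^ (k * (h + t + t)) ≗ q^ (K * h + t * w)
          shift₂ n = trans (sym (q^-+ (h + t) (k * (h + t + t)) n)) (cong (λ e → q^ e n)
            (solve 3 (λ k h t → (h :+ t) :+ k :* (h :+ t :+ t)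
              := (con 1 :+ k) :* h :+ t :* (con 1 :+ con 2 :* k)) refl k h t))

    private
      W = G ⊛ y

      count-Y₁ : ∀ o h n → CountedLength (Y o h 1) K (q^ (K * h) ⊛ y) n
      count-Y₁ o h n = subst (HasCard _) (series n) (count-Y o h 1 n (s≤s z≤n))
        where
        series : q^ (K * h + 1 * w) ⊛ (g ⊛ u) ≗ q^ (K * h) ⊛ y
        series = 𝕊.trans
          (𝕊.*-congʳ {g ⊛ u} (λ n → trans (cong (λ e → q^ (K * h + e) n) (ℕ.*-identityˡ w)) (q^-+ (K * h) w n)))
          (⊛-assoc (q^ (K * h)) (q^ w) (g ⊛ u))

      -- Without the factor q^(Kh), `U⇔` and `V⇔` read U = q^K V + y and V = U + y. Their solution V
      -- = 2y / (1 - q^K), U = (1 + q^K) y / (1 - q^K) is the origin of `V-series` and `U-series`.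
      series-U : ∀ h → q^ (K * suc h) ⊛ V-series K ⊕ q^ (K * h) ⊛ y ≗ q^ (K * h) ⊛ U-series K
      series-U h = begin
        q^ (K * suc h) ⊛ (G ⊛ (y ⊕ y)) ⊕ e ⊛ y
          ≈⟨ 𝕊.+-congʳ {e ⊛ y} (𝕊.*-congʳ {G ⊛ (y ⊕ y)} shift) ⟩
        (q^ K ⊛ e) ⊛ (G ⊛ (y ⊕ y)) ⊕ e ⊛ y
          ≈⟨ solve𝕊 4 (λ x e G y → (x ⊛′ e) ⊛′ (G ⊛′ (y ⊕′ y)) ⊕′ e ⊛′ y
                                    ≗′ e ⊛′ ((y ⊕′ x ⊛′ (G ⊛′ y)) ⊕′ x ⊛′ (G ⊛′ y)))
               (λ _ → refl) (q^ K) e G y ⟩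
        e ⊛ ((y ⊕ q^ K ⊛ W) ⊕ q^ K ⊛ W)
          ≈⟨ 𝕊.*-congˡ {e} (𝕊.+-congʳ {q^ K ⊛ W} (geometric-⊛ K y)) ⟨
        e ⊛ (W ⊕ q^ K ⊛ W)
          ≈⟨ solve𝕊 3 (λ e x W → e ⊛′ (W ⊕′ x ⊛′ W) ≗′ e ⊛′ ((con𝕊 1 ⊕′ x) ⊛′ W)) (λ _ → refl) e (q^ K) W ⟩
        e ⊛ U-series K ∎
        where
        open import Relation.Binary.Reasoning.Setoid 𝕊.setoid
        e = q^ (K * h)
        shift : q^ (K * suc h) ≗ q^ K ⊛ e
        shift n = trans (cong (λ e → q^ e n) (ℕ.*-suc K h)) (q^-+ K (K * h) n)

      series-V : ∀ h → q^ (K * h) ⊛ U-series K ⊕ q^ (K * h) ⊛ y ≗ q^ (K * h) ⊛ V-series K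
      series-V h = begin
        e ⊛ ((q^ 0 ⊕ q^ K) ⊛ W) ⊕ e ⊛ y
          ≈⟨ solve𝕊 4 (λ e x W y → e ⊛′ ((con𝕊 1 ⊕′ x) ⊛′ W) ⊕′ e ⊛′ y ≗′ e ⊛′ ((y ⊕′ x ⊛′ W) ⊕′ W))
               (λ _ → refl) e (q^ K) W y ⟩
        e ⊛ ((y ⊕ q^ K ⊛ W) ⊕ W)
          ≈⟨ 𝕊.*-congˡ {e} (𝕊.+-congʳ {W} (geometric-⊛ K y)) ⟨
        e ⊛ (W ⊕ W)
          ≈⟨ solve𝕊 3 (λ e G y → e ⊛′ (G ⊛′ y ⊕′ G ⊛′ y) ≗′ e ⊛′ (G ⊛′ (y ⊕′ y))) (λ _ → refl) e G y ⟩
        e ⊛ V-series K ∎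
        where
        open import Relation.Binary.Reasoning.Setoid 𝕊.setoid
        e = q^ (K * h)

    mutual
      count-V-suc : ∀ d h n → n < h + d → CountedLength (V h) K (q^ (K * h) ⊛ V-series K) n
      count-V-suc zero    h n n<h = HasCard-0 (V-series K)
        (ℕ.<-≤-trans n<h′ (ℕ.m≤n*m h K))
        (too-heavy (λ (_ , h+j≤m) → ℕ.<-≤-trans n<h′ (ℕ.≤-trans (ℕ.m≤m+n h _) h+j≤m)))
        where n<h′ = subst (n <_) (ℕ.+-identityʳ h) n<h
      count-V-suc (suc d) h n n<h+d = subst (HasCard _) (series-V h n)
        (HasCard-split V⇔ U-Y-disjoint (λ ()) (count-U-suc d h n (subst (n <_) (ℕ.+-suc h d) n<h+d)) (count-Y₁ true h n))

      count-U-suc : ∀ d h n → n < suc h + d → CountedLength (U h) K (q^ (K * h) ⊛ U-series K) n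
      count-U-suc d h n n<h+d = subst (HasCard _) (series-U h n)
        (HasCard-split U⇔ V-Y-disjoint (λ ()) (count-V-suc d (suc h) n n<h+d) (count-Y₁ false h n))

  count-U : ∀ k h n → CountedLength (U h) k (q^ (k * h) ⊛ U-series k) n
  count-U zero    h n = subst (HasCard _) (sym (⊛-identityˡ (q^ 0) n)) (count-empty (U h) n)
  count-U (suc k) h n = count-U-suc k (count-U k) n h n (s≤s (ℕ.m≤n+m n h))

  count-V : ∀ k n → CountedLength (V 0) k (L-term k) n
  count-V zero    n = subst (HasCard _) (V-series≗L-term 0 n) (count-empty (V 0) n)
  count-V (suc k) n = subst (HasCard _)
    (trans (cong (λ e → (q^ e ⊛ V-series (suc k)) n) (ℕ.*-zeroʳ (suc k)))
      (trans (⊛-identityˡ (V-series (suc k)) n) (V-series≗L-term (suc k) n)))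
    (count-V-suc k (count-U k) (suc n) 0 n (ℕ.n<1+n n))

  count-V-≤ : ∀ K n → HasCard (λ xs → Chain (V 0) xs × length xs ≤ K × total xs ≡ n) (L-series K n)
  count-V-≤ zero    n = HasCard-resp
    (λ xs → mk⇔ (λ (c , l , e) → c , ℕ.≤-reflexive l , e) (λ (c , l , e) → c , ℕ.n≤0⇒n≡0 l , e)) (count-V 0 n)
  count-V-≤ (suc K) n = HasCard-resp
    (λ xs → mk⇔
      Sum.[ (λ (c , l , e) → c , ℕ.≤-reflexive l , e) , (λ (c , l , e) → c , ℕ.m≤n⇒m≤1+n l , e) ]
      (λ (c , l , e) → Sum.map (λ l → c , l , e) (λ l → c , l , e) (≤-suc l)))
    (HasCard-⊎ (count-V (suc K) n) (count-V-≤ K n) (λ (_ , l , _) (_ , l′ , _) → ℕ.1+n≰n (subst (_≤ K) l l′)))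
    where
    ≤-suc : ∀ {l} → l ≤ suc K → l ≡ suc K ⊎ l ≤ K
    ≤-suc l≤ = Sum.swap (Sum.map₁ ℕ.≤-pred (ℕ.m≤n⇒m<n∨m≡n l≤))

  private
    difference : Occ → Occ → ℤ.ℤ
    difference x y = weightedDifference (part y) (part x)

    next : Occ → Occ → ℕ
    next x y = upper x + proj₂ (part y)

    difference≡ : ∀ x y → difference x y ≡ ℤ.+ proj₁ (part y) ℤ.- ℤ.+ next x y
    difference≡ ((n , j) , _) ((m , i) , _) =
      solveℤ 4 (λ m n i j → m :- n :- i :- j :=ℤ m :- ((n :+ℤ j) :+ℤ i)) refl (ℤ.+ m) (ℤ.+ n) (ℤ.+ i) (ℤ.+ j)

    difference≥0 : ∀ x y → ℤ.0ℤ ℤ.≤ difference x y ⇔ next x y ≤ proj₁ (part y)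
    difference≥0 x y = mk⇔
      (λ p → ℤ.drop‿+≤+ (ℤ.0≤i-j⇒j≤i (subst (ℤ.0ℤ ℤ.≤_) (difference≡ x y) p)))
      (λ p → subst (ℤ.0ℤ ℤ.≤_) (sym (difference≡ x y)) (ℤ.i≤j⇒0≤j-i (ℤ.+≤+ p)))

    difference≡0 : ∀ x y → difference x y ≡ ℤ.0ℤ ⇔ proj₁ (part y) ≡ next x y
    difference≡0 x y = mk⇔
      (λ p → ℤ.+-injective (ℤ.i-j≡0⇒i≡j _ _ (trans (sym (difference≡ x y)) p)))
      (λ p → trans (difference≡ x y) (ℤ.i≡j⇒i-j≡0 (cong ℤ.+_ p)))

    Unextended : Occ → Occ → Set
    Unextended x y = difference x y ≡ ℤ.0ℤ → ¬ Overlined y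

    blocks-head : ∀ x xs → ∃₂ λ ys bs → blocks (x ∷ xs) ≡ (x List⁺.∷ ys) ∷ bs
    blocks-head x xs with blocks xs
    ... | []     = _ , _ , refl
    ... | b ∷ bs with difference x (List⁺.head b) ℤ.≟ ℤ.0ℤ
    ...   | yes _ = _ , _ , refl
    ...   | no  _ = _ , _ , refl

    -- This makes (ii) local: a part lies in the tail of its block exactly when its difference from
    -- its predecessor is 0.
    blocks-∷ : ∀ x y zs → All OnlySmallestOverlined (blocks (x ∷ y ∷ zs)) ⇔
               (Unextended x y × All OnlySmallestOverlined (blocks (y ∷ zs)))
    blocks-∷ x y zs with blocks (y ∷ zs) | blocks-head y zs
    ... | .((y List⁺.∷ ys) ∷ bs) | ys , bs , refl with difference x y ℤ.≟ ℤ.0ℤ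
    ...   | yes d≡0 = mk⇔ (λ { ((¬o ∷ ¬os) ∷ rest) → (λ _ → ¬o) , ¬os ∷ rest })
                          (λ { (¬o , ¬os ∷ rest) → (¬o d≡0 ∷ ¬os) ∷ rest })
    ...   | no  d≢0 = mk⇔ (λ { (_ ∷ rest) → (λ d≡0 → contradiction d≡0 d≢0) , rest })
                          (λ (_ , rest) → [] ∷ rest)

    IsPart : Occ → Set
    IsPart = PartSystem.IsPart nCopiesOfN ∘ part

    -- For x = nⱼ and y = mᵢ, a nonnegative gap says n + j + i ≤ m with i ≥ 1. Hence n < m, which
    -- gives the order, and i ≤ m.
    U-step : ∀ x y → U (upper x) y ⇔ (IsPart y × x ⊴ y × ℤ.0ℤ ℤ.≤ difference x y × Unextended x y)
    U-step x y = mk⇔ forth back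
      where
      spaced : 1 ≤ proj₂ (part y) → next x y ≤ proj₁ (part y) →
               (¬ Overlined y ⊎ next x y < proj₁ (part y)) →
               IsPart y × x ⊴ y × ℤ.0ℤ ℤ.≤ difference x y × Unextended x y
      spaced p le gap = (p , ℕ.≤-trans (ℕ.m≤n+m _ (upper x)) le)
        , inj₁ (inj₁ (ℕ.≤-trans (ℕ.≤-trans (ℕ.≤-reflexive (ℕ.+-comm 1 _)) (ℕ.+-mono-≤ (ℕ.m≤m+n (proj₁ (part x)) _) p)) le))
        , from (difference≥0 x y) le
        , λ d≡0 → Sum.[ (λ ¬o → ¬o) , (λ lt → contradiction (sym (to (difference≡0 x y) d≡0)) (ℕ.<⇒≢ lt)) ] gap
      forth : U (upper x) y → IsPart y × x ⊴ y × ℤ.0ℤ ℤ.≤ difference x y × Unextended x y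
      forth (p , inj₁ lt)        = spaced p (ℕ.<⇒≤ lt) (inj₂ lt)
      forth (p , inj₂ (eq , ¬o)) = spaced p (ℕ.≤-reflexive eq) (inj₁ ¬o)
      back : IsPart y × x ⊴ y × ℤ.0ℤ ℤ.≤ difference x y × Unextended x y → U (upper x) y
      back ((p , _) , _ , d≥0 , un) with ℕ.m≤n⇒m<n∨m≡n (to (difference≥0 x y) d≥0)
      ... | inj₁ lt = p , inj₁ lt
      ... | inj₂ eq = p , inj₂ (eq , un (from (difference≡0 x y) (sym eq)))

    Separated : Occ → List Occ → Set
    Separated x xs = All IsPart xs × Linked _⊴_ (x ∷ xs) × LCondition (x ∷ xs)

    chain⇔ : ∀ x xs → Chain (U (upper x)) xs ⇔ Separated x xs
    chain⇔ x []       = mk⇔ (λ _ → [] , [-] , [-] , [] ∷ []) (λ _ → tt)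
    chain⇔ x (y ∷ ys) = mk⇔
      (λ (h , ch) →
        let p , x⊴y , d≥0 , un = to (U-step x y) h
            ps , ordered , spaced , marked = to (chain⇔ y ys) ch
        in p ∷ ps , x⊴y ∷ ordered , d≥0 ∷ spaced , from (blocks-∷ x y ys) (un , marked))
      (λ { (p ∷ ps , x⊴y ∷ ordered , d≥0 ∷ spaced , marked) →
        let un , marked′ = to (blocks-∷ x y ys) marked
        in from (U-step x y) (p , x⊴y , d≥0 , un) , from (chain⇔ y ys) (ps , ordered , spaced , marked′) })

  -- Every value is at least 1, so a list of total n has at most n parts and `L-series n` accounts
  -- for all of them.
  length≤total : ∀ {H : Occ → Set} → (∀ {y} → H y → 1 ≤ proj₁ (part y)) → ∀ xs → Chain H xs → length xs ≤ total xs
  length≤total pos []       _        = z≤n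
  length≤total pos (x ∷ xs) (h , ch) = ℕ.+-mono-≤ (pos h) (length≤total
    (λ {y} h → let (1≤j , j≤n) , _ = to (U-step x y) h in ℕ.≤-trans 1≤j j≤n) xs ch)

  overpartition⇔ : ∀ n xs → (Chain (V 0) xs × length xs ≤ n × total xs ≡ n) ⇔ (IsOverpartition n xs × LCondition xs)
  overpartition⇔ n []       = mk⇔ (λ (_ , _ , eq) → ([] , [] , eq) , [] , [])
                                  (λ ((_ , _ , eq) , _) → tt , z≤n , eq)
  overpartition⇔ n (x ∷ xs) = mk⇔
    (λ ((p , ch) , _ , eq) →
      let ps , ordered , cond = to (chain⇔ x xs) ch in (p ∷ ps , ordered , eq) , cond)
    (λ { ((p ∷ ps , ordered , eq) , cond) →
      let c = p , from (chain⇔ x xs) (ps , ordered , cond)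
      in c , ℕ.≤-trans (length≤total {V 0} (λ (1≤j , j≤n) → ℕ.≤-trans 1≤j j≤n) (x ∷ xs) c) (ℕ.≤-reflexive eq) , eq })

  L≡ : ∀ n → L n ≡ L-series n n
  L≡ n = card-unique (Overpartitions.finite nCopiesOfN LCondition? n)
    (HasCard-resp (overpartition⇔ n) (count-V-≤ n n))

theorem30 : (m : ℕ) → 1 ≤ m → J m ≡ L m
theorem30 m _ = begin
  J m          ≡⟨ OrdinaryCount.J≡ m ⟩
  J-series m m ≡⟨ _≈⟦_⟧_.coeff (J-series≈L-series m) ℕ.≤-refl ⟩
  L-series m m ≡⟨ CopiesCount.L≡ m ⟨
  L m          ∎
  where open ≡-Reasoning
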